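{- Let $k>1$, let $U_1\in\mathbb{F}_q^{k\times k}$, $U_2\in\mathbb{F}_q^{k\times(k+1)}$, $\mathbf{v}_1\in\mathbb{F}_q^k$, $\mathbf{v}_2\in\mathbb{F}_q^{k+1}$ be such that $(U_1\mid U_2)$ has rank $k$ and $V=(V_1\mid V_2)=\begin{pmatrix}U_1&U_2\\ \mathbf{v}_1&\mathbf{v}_2\end{pmatrix}$ has rank $k+1$, where $V_1=\begin{pmatrix}U_1\\ \mathbf{v}_1\end{pmatrix}$ and $V_2=\begin{pmatrix}U_2\\ \mathbf{v}_2\end{pmatrix}$. Let $\mathcal{F}=(\mathcal{F}_1,\dots,\mathcal{F}_{2k})$ be a full flag on $\mathbb{F}_q^{2k+1}$ with $\mathcal{F}_k=\mathrm{rowsp}(U_1\mid U_2)$ and $\mathcal{F}_{k+1}=\mathrm{rowsp}(V)$. The following are equivalent: (i) the flag code $\mathrm{Orb}_{\mathbf{G}}(\mathcal{F})$ is an optimum distance flag code; (ii) $U_1$ and $V_2$ are invertible matrices. In this situation, $|\mathrm{Orb}_{\mathbf{G}}(\mathcal{F})|=|\mathbf{G}|=q^{k+1}-1$.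
   Context: Let $M_{k+1}\in\mathrm{GL}(k+1,q)$ be the companion matrix of a primitive polynomial of degree $k+1$ over $\mathbb{F}_q$, let $g=\begin{pmatrix}I_k&0\\0&M_{k+1}\end{pmatrix}\in\mathrm{GL}(2k+1,q)$ and $\mathbf{G}=\langle g\rangle$. A full flag on $\mathbb{F}_q^{2k+1}$ is a chain $\mathcal{F}_1\subsetneq\cdots\subsetneq\mathcal{F}_{2k}$ of subspaces with $\dim\mathcal{F}_i=i$. $\mathrm{GL}(2k+1,q)$ acts on subspaces by $\mathcal{V}\cdot A=\mathrm{rowsp}(VA)$ and on flags componentwise. With $d_S(\mathcal{A},\mathcal{B})=\dim(\mathcal{A}+\mathcal{B})-\dim(\mathcal{A}\cap\mathcal{B})$ and $d_f(\mathcal{F},\mathcal{F}')=\sum_i d_S(\mathcal{F}_i,\mathcal{F}'_i)$, a flag code $\mathcal{C}$ of type $(t_1,\dots,t_r)$ on $\mathbb{F}_q^n$ is an optimum distance flag code if its minimum flag distance between distinct members ($0$ if $|\mathcal{C}|=1$) equals $2\left(\sum_{2t_i\leq n}t_i+\sum_{2t_i>n}(n-t_i)\right)$. -}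

module Defs where

open import Level using (0ℓ)
open import Data.Nat as ℕ using (ℕ; zero; suc; _∸_; _^_; _≤_; _<_; _<?_; _≟_)
open import Data.Fin as Fin using (Fin; splitAt; toℕ; fromℕ<)
open import Data.Sum using (_⊎_; inj₁; inj₂; [_,_])
open import Data.Product using (Σ; Σ-syntax; ∃; _×_; _,_)
open import Data.List using (List; length)
open import Data.List.Membership.Propositional using (_∈_)
open import Data.List.Relation.Unary.Unique.Propositional using (Unique)
open import Relation.Binary.PropositionalEquality using (_≡_)
open import Relation.Nullary using (¬_; yes; no)
open import Algebra.Structures using (IsCommutativeRing)

record FiniteField : Set₁ where
  field
    Carrier : Set
    _+F_ _*F_ : Carrier → Carrier → Carrier
    -F_ : Carrier → Carrier
    0F 1F : Carrier
    isCommutativeRing : IsCommutativeRing _≡_ _+F_ _*F_ -F_ 0F 1F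
    0≢1 : ¬ (0F ≡ 1F)
    inverse : ∀ x → ¬ (x ≡ 0F) → Σ[ y ∈ Carrier ] (x *F y ≡ 1F)
    elements : List Carrier
    elements-complete : ∀ x → x ∈ elements
    elements-unique : Unique elements

  q : ℕ
  q = length elements

IsLeast : (ℕ → Set) → ℕ → Set
IsLeast P n = P n × (∀ m → P m → n ≤ m)

sumTo : ℕ → (ℕ → ℕ) → ℕ
sumTo zero f = 0
sumTo (suc m) f = sumTo m f ℕ.+ f (suc m)

-- Maximal flag distance for the full type (1,...,n-1) on F_q^n:
-- 2 ( Σ_{2t ≤ n} t + Σ_{2t > n} (n - t) ).
odBound : ℕ → ℕ
odBound n = 2 ℕ.* sumTo (n ∸ 1) term
  where
  term : ℕ → ℕ
  term t with (2 ℕ.* t) ℕ.≤? n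
  ... | yes _ = t
  ... | no  _ = n ∸ t

module Ops (F : FiniteField) where
  open FiniteField F public

  Vec : ℕ → Set
  Vec n = Fin n → Carrier

  Mat : ℕ → ℕ → Set
  Mat m n = Fin m → Fin n → Carrier

  ∑ : ∀ {n} → (Fin n → Carrier) → Carrier
  ∑ {zero} f = 0F
  ∑ {suc n} f = f Fin.zero +F ∑ (λ i → f (Fin.suc i))

  ∑ℕ : ℕ → (ℕ → Carrier) → Carrier
  ∑ℕ zero f = 0F
  ∑ℕ (suc m) f = ∑ℕ m f +F f m

  _≈ᵥ_ : ∀ {n} → Vec n → Vec n → Set
  v ≈ᵥ w = ∀ j → v j ≡ w j

  _≈ₘ_ : ∀ {m n} → Mat m n → Mat m n → Set
  A ≈ₘ B = ∀ i j → A i j ≡ B i j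

  _·ᵥ_ : ∀ {m n} → Vec m → Mat m n → Vec n
  (c ·ᵥ A) j = ∑ (λ i → c i *F A i j)

  _·ₘ_ : ∀ {m n p} → Mat m n → Mat n p → Mat m p
  (A ·ₘ B) i = A i ·ᵥ B

  δ : ∀ {n} → Fin n → Fin n → Carrier
  δ i j with toℕ i ≟ toℕ j
  ... | yes _ = 1F
  ... | no  _ = 0F

  I : ∀ {n} → Mat n n
  I = δ

  _^ₘ_ : ∀ {n} → Mat n n → ℕ → Mat n n
  A ^ₘ zero = I
  A ^ₘ suc e = A ·ₘ (A ^ₘ e)

  Invertible : ∀ {n} → Mat n n → Set
  Invertible A = Σ[ W ∈ Mat _ _ ] ((A ·ₘ W) ≈ₘ I × (W ·ₘ A) ≈ₘ I)

  hcat : ∀ {m n p} → Mat m n → Mat m p → Mat m (n ℕ.+ p)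
  hcat {n = n} A B i j = [ A i , B i ] (splitAt n j)

  addRow : ∀ {m n} → Mat m n → Vec n → Mat (suc m) n
  addRow {zero} U v Fin.zero = v
  addRow {suc m} U v Fin.zero = U Fin.zero
  addRow {suc m} U v (Fin.suc i) = addRow (λ r → U (Fin.suc r)) v i

  blockDiag : ∀ {m n} → Mat m m → Mat n n → Mat (m ℕ.+ n) (m ℕ.+ n)
  blockDiag {m} A B i j with splitAt m i | splitAt m j
  ... | inj₁ i' | inj₁ j' = A i' j'
  ... | inj₂ i' | inj₂ j' = B i' j'
  ... | inj₁ _  | inj₂ _  = 0F
  ... | inj₂ _  | inj₁ _  = 0F

  Subspace : ℕ → Set₁
  Subspace n = Vec n → Set

  InRowsp : ∀ {m n} → Mat m n → Subspace n
  InRowsp A v = Σ[ c ∈ Vec _ ] (v ≈ᵥ (c ·ᵥ A))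

  LinIndepRows : ∀ {m n} → Mat m n → Set
  LinIndepRows A = ∀ c → (c ·ᵥ A) ≈ᵥ (λ _ → 0F) → ∀ i → c i ≡ 0F

  _⊆ˢ_ : ∀ {n} → Subspace n → Subspace n → Set
  P ⊆ˢ Q = ∀ v → P v → Q v

  _≐ˢ_ : ∀ {n} → Subspace n → Subspace n → Set
  P ≐ˢ Q = P ⊆ˢ Q × Q ⊆ˢ P

  HasDim : ∀ {n} → Subspace n → ℕ → Set
  HasDim {n} P d = Σ[ B ∈ Mat d n ] (LinIndepRows B × (P ≐ˢ InRowsp B))

  HasRank : ∀ {m n} → Mat m n → ℕ → Set
  HasRank A r = HasDim (InRowsp A) r

  _+ˢ_ : ∀ {n} → Subspace n → Subspace n → Subspace n
  (P +ˢ Q) v = Σ[ a ∈ Vec _ ] Σ[ b ∈ Vec _ ] (P a × Q b × v ≈ᵥ (λ j → a j +F b j))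

  _∩ˢ_ : ∀ {n} → Subspace n → Subspace n → Subspace n
  (P ∩ˢ Q) v = P v × Q v

  SubDist : ∀ {n} → Subspace n → Subspace n → ℕ → Set
  SubDist P Q d = Σ[ s ∈ ℕ ] Σ[ t ∈ ℕ ] (HasDim (P +ˢ Q) s × HasDim (P ∩ˢ Q) t × d ≡ s ∸ t)

  _·ˢ_ : ∀ {n} → Subspace n → Mat n n → Subspace n
  (P ·ˢ A) w = Σ[ v ∈ Vec _ ] (P v × w ≈ᵥ (v ·ᵥ A))

  -- Flags on F_q^n: families indexed by i = 1,...,n-1 (other indices ignored).

  Flag : ℕ → Set₁
  Flag n = ℕ → Subspace n

  IsFullFlag : ∀ n → Flag n → Set
  IsFullFlag n 𝓕 = ∀ i → 1 ≤ i → i < n →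
    HasDim (𝓕 i) i × (suc i < n → 𝓕 i ⊆ˢ 𝓕 (suc i))

  FlagEq : ∀ n → Flag n → Flag n → Set
  FlagEq n 𝓕 𝓕' = ∀ i → 1 ≤ i → i < n → 𝓕 i ≐ˢ 𝓕' i

  _·ᶠ_ : ∀ {n} → Flag n → Mat n n → Flag n
  (𝓕 ·ᶠ A) i = 𝓕 i ·ˢ A

  FlagDist : ∀ n → Flag n → Flag n → ℕ → Set
  FlagDist n 𝓕 𝓕' d = Σ[ ds ∈ (ℕ → ℕ) ]
    ((∀ i → 1 ≤ i → i < n → SubDist (𝓕 i) (𝓕' i) (ds i)) × d ≡ sumTo (n ∸ 1) ds)

  FlagCode : ℕ → Set₁
  FlagCode n = Flag n → Set

  MinDistIs : ∀ n → FlagCode n → ℕ → Set₁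
  MinDistIs n C D =
    (∀ 𝓕 𝓕' → C 𝓕 → C 𝓕' → ¬ FlagEq n 𝓕 𝓕' → ∀ d → FlagDist n 𝓕 𝓕' d → D ≤ d)
    × ((Σ[ 𝓕 ∈ Flag n ] Σ[ 𝓕' ∈ Flag n ]
          (C 𝓕 × C 𝓕' × ¬ FlagEq n 𝓕 𝓕' × FlagDist n 𝓕 𝓕' D))
       ⊎ (Σ[ 𝓕 ∈ Flag n ] C 𝓕 × (∀ 𝓕' → C 𝓕' → FlagEq n 𝓕 𝓕') × D ≡ 0))

  IsOptimumDistance : ∀ n → FlagCode n → Set₁
  IsOptimumDistance n C = MinDistIs n C (odBound n)

  Orbit : ∀ {n} → Flag n → Mat n n → FlagCode n
  Orbit {n} 𝓕 g 𝓕' = Σ[ j ∈ ℕ ] FlagEq n 𝓕' (𝓕 ·ᶠ (g ^ₘ j))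

  OrbitCard : ∀ {n} → Flag n → Mat n n → ℕ → Set
  OrbitCard {n} 𝓕 g N =
    (∀ i j → i < N → j < N → ¬ (i ≡ j) → ¬ FlagEq n (𝓕 ·ᶠ (g ^ₘ i)) (𝓕 ·ᶠ (g ^ₘ j)))
    × (∀ j → Σ[ i ∈ ℕ ] (i < N × FlagEq n (𝓕 ·ᶠ (g ^ₘ j)) (𝓕 ·ᶠ (g ^ₘ i))))

  GroupOrder : ∀ {n} → Mat n n → ℕ → Set
  GroupOrder g N = IsLeast (λ e → 0 < e × (g ^ₘ e) ≈ₘ I) N

  Poly : Set
  Poly = ℕ → Carrier

  _*ₚ_ : Poly → Poly → Poly
  (f *ₚ g) m = ∑ℕ (suc m) (λ i → f i *F g (m ∸ i))

  FiniteSupport : Poly → Set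
  FiniteSupport h = Σ[ d ∈ ℕ ] (∀ i → d < i → h i ≡ 0F)

  _∣ₚ_ : Poly → Poly → Set
  p ∣ₚ r = Σ[ h ∈ Poly ] (FiniteSupport h × (∀ i → (p *ₚ h) i ≡ r i))

  monic : ∀ {m} → Vec m → Poly
  monic {m} a i with i <? m
  ... | yes i<m = a (fromℕ< i<m)
  ... | no _ with i ≟ m
  ...   | yes _ = 1F
  ...   | no  _ = 0F

  xe-1 : ℕ → Poly
  xe-1 e i = (ind (i ≟ e) 1F) +F (ind (i ≟ 0) (-F 1F))
    where
    ind : ∀ {A : Set} → Relation.Nullary.Dec A → Carrier → Carrier
    ind (yes _) x = x
    ind (no _) _ = 0F

  IsPrimitive : ∀ {m} → Vec (suc m) → Set
  IsPrimitive {m} a = ¬ (a Fin.zero ≡ 0F)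
    × IsLeast (λ e → 0 < e × (monic a ∣ₚ xe-1 e)) (q ^ suc m ∸ 1)

  -- companion matrix of x^m + a_{m-1}x^{m-1}+...+a_0 (row convention):
  -- row i = e_{i+1} for i < m-1, last row = (-a_0, ..., -a_{m-1})
  companion : ∀ {m} → Vec m → Mat m m
  companion {m} a i j with suc (toℕ i) ≟ m
  ... | yes _ = -F (a j)
  ... | no _ with suc (toℕ i) ≟ toℕ j
  ...   | yes _ = 1F
  ...   | no  _ = 0F

{-# OPTIONS --safe #-}

-- The powers of M act simply transitively on the nonzero vectors of F^{k+1}. Write P = F_k and Q = F_{k+1}, and split
-- a vector as (x, y) with x in F^k. Then U₁ is invertible iff P meets 0 ⊕ F^{k+1} trivially, V₂ is invertible iff Q
-- meets F^k ⊕ 0 trivially, and the optimum distance is attained by F and F g^j iff P ∩ P g^j = 0 and Q + Q g^j is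
-- everything.
--
-- (ii) ⇒ (i): if (x, y) ∈ P and (x, y M^i) = (x, y M^j) with M^i ≠ M^j, then y = 0, so x = 0. Given (a, b), take
-- (a, y) ∈ P and (x, e) ∈ Q with e (M^j − M^i) = b − y M^i; then (a, b) = ((a, y) − (x, e)) g^i + (x, e) g^j.
--
-- (i) ⇒ (ii): no nonzero vector of P is fixed by g, and if a nonzero vector of P returns to P under g^j, then g^j
-- fixes the flag, in particular the line F_1. Hence two vectors of P with the same first component are related by
-- such a g^j, which leads to a contradiction when that component is 0, and then in the same way for Q.
module Submission where

open import Algebra.Bundles using (CommutativeRing)
open import Data.Empty using (⊥)
open import Data.Fin as Fin using (Fin; zero; suc; toℕ; fromℕ<; splitAt; _↑ˡ_; _↑ʳ_; finToFun; funToFin)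
import Data.Fin.Properties as Finₚ
open import Data.List using (List; lookup)
open import Data.List.Membership.Propositional.Properties using (∈-lookup)
import Data.List.Relation.Unary.All as All
import Data.List.Relation.Unary.AllPairs as AllPairs
open import Data.List.Relation.Unary.Any using (index)
open import Data.List.Relation.Unary.Any.Properties using (lookup-index)
open import Data.List.Relation.Unary.Unique.Propositional using (Unique)
open import Data.Nat as ℕ using (ℕ; zero; suc; _+_; _*_; _≤_; _<_; _^_; _∸_; z≤n; s≤s)
open import Data.Nat.DivMod using (_%_; _/_; m%n<n; m≡m%n+[m/n]*n)
import Data.Nat.Properties as ℕₚ
open import Data.Nat.Tactic.RingSolver using (solve-∀)
open import Data.Product using (Σ-syntax; ∃; _×_; _,_; proj₁; proj₂)
open import Data.Sum using (inj₁; inj₂; [_,_])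
open import Data.Vec.Functional using (_∷_; _++_; tail)
open import Data.Vec.Functional.Properties using (lookup-++ˡ; lookup-++ʳ)
open import Defs
open import Function using (_∘_; id)
open import Level using (0ℓ)
open import Relation.Binary.Definitions using (tri<; tri≈; tri>)
open import Relation.Binary.PropositionalEquality hiding ([_])
open import Relation.Nullary using (¬_; Dec; yes; no; contradiction)
open import Relation.Nullary.Decidable using (map′)

-- Subspaces are predicates, and equality of flags is never decided. Optimality only speaks of flags
-- known to differ, so a power of `g` that returns a nonzero vector of `P` to `P` is shown to
-- stabilise the flag only up to double negation; this suffices, since each use of it ends in a
-- contradiction. All dimensions enter through a single total: the bound is the sum of the maximal
-- distances at each dimension, so a flag distance that reaches it is maximal at every dimension, in
-- particular at `k` and `k + 1`. Conversely, these two dimensions control all others by nesting.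
-- The hypothesis `1 < k` provides a second vector of `P` independent of a given one; the necessity
-- argument moves that vector. The line `𝓕 1` matters because a stabiliser of the flag acts on its
-- generator by a scalar, and a power of `M` that scales one nonzero vector scales all vectors.
-- Finiteness replaces the exchange lemma: dimensions are compared by counting, and membership in a
-- row space is decided by search.

lookup-injective : ∀ {A : Set} {xs : List A} → Unique xs → ∀ i j → lookup xs i ≡ lookup xs j → i ≡ j
lookup-injective (_ AllPairs.∷ _)    zero    zero    _  = refl
lookup-injective (x≢ AllPairs.∷ _)   zero    (suc j) eq = contradiction eq (All.lookup x≢ (∈-lookup j))
lookup-injective (x≢ AllPairs.∷ _)   (suc i) zero    eq = contradiction (sym eq) (All.lookup x≢ (∈-lookup i))
lookup-injective (_ AllPairs.∷ uniq) (suc i) (suc j) eq = cong suc (lookup-injective uniq i j eq)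

-- Vectors, row spaces and dimension over a finite field.

module LinearAlgebra (F : FiniteField) where
  open Ops F public
    renaming (_+F_ to infixl 6 _+F_; _*F_ to infixl 7 _*F_; -F_ to infix 8 -F_;
              _·ᵥ_ to infixl 8 _·ᵥ_; _·ₘ_ to infixl 8 _·ₘ_; _^ₘ_ to infixr 9 _^ₘ_)

  commutativeRing : CommutativeRing 0ℓ 0ℓ
  commutativeRing = record { isCommutativeRing = isCommutativeRing }

  open CommutativeRing commutativeRing public
    using (+-assoc; +-comm; +-identityˡ; +-identityʳ; -‿inverseˡ; -‿inverseʳ;
           *-assoc; *-comm; *-identityˡ; *-identityʳ; distribˡ; distribʳ; zeroˡ; zeroʳ)
  open import Algebra.Properties.Ring (CommutativeRing.ring commutativeRing) public
    using (-‿distribˡ-*; -‿distribʳ-*; -1*x≈-x) renaming (-0#≈0# to -0≡0)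
  open import Algebra.Properties.Group (CommutativeRing.+-group commutativeRing) public
    using () renaming (x∙y⁻¹≈ε⇒x≈y to x-y≡0⇒x≡y; inverseˡ-unique to x+y≡0⇒x≡-y; ∙-cancelˡ to +-cancelˡ; ∙-cancelʳ to +-cancelʳ)
  open import Algebra.Properties.CommutativeSemigroup
    (CommutativeRing.+-commutativeSemigroup commutativeRing) public
    using () renaming (interchange to +-interchange)

  infixl 6 _⊕_
  infixr 7 _⊙_
  infix 4 _≋_

  _≋_ : ∀ {n} → Vec n → Vec n → Set
  _≋_ = _≈ᵥ_

  0ᵥ : ∀ {n} → Vec n
  0ᵥ _ = 0F

  _⊕_ : ∀ {n} → Vec n → Vec n → Vec n
  (v ⊕ w) j = v j +F w j

  _⊙_ : ∀ {n} → Carrier → Vec n → Vec n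
  (s ⊙ v) j = s *F v j

  ⊖_ : ∀ {n} → Vec n → Vec n
  (⊖ v) j = -F v j

  code : Carrier → Fin q
  code x = index (elements-complete x)

  decode : Fin q → Carrier
  decode = lookup elements

  decode-code : ∀ x → decode (code x) ≡ x
  decode-code x = sym (lookup-index (elements-complete x))

  code-injective : ∀ {x y} → code x ≡ code y → x ≡ y
  code-injective {x} {y} eq = trans (sym (decode-code x)) (trans (cong decode eq) (decode-code y))

  _≟F_ : (x y : Carrier) → Dec (x ≡ y)
  x ≟F y = map′ code-injective (cong code) (code x Finₚ.≟ code y)

  1<q : 1 < q
  1<q = ℕₚ.≰⇒> λ q≤1 → 0≢1 (code-injective (atMostOne q≤1 (code 0F) (code 1F)))
    where
    atMostOne : ∀ {n} → n ≤ 1 → (i j : Fin n) → i ≡ j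
    atMostOne (s≤s z≤n) zero zero = refl

  codeᵥ : ∀ {n} → Vec n → Fin (q ^ n)
  codeᵥ v = funToFin (code ∘ v)

  decodeᵥ : ∀ {n} → Fin (q ^ n) → Vec n
  decodeᵥ i = decode ∘ finToFun i

  decode-codeᵥ : ∀ {n} (v : Vec n) → decodeᵥ (codeᵥ v) ≋ v
  decode-codeᵥ v j = trans (cong decode (Finₚ.finToFun-funToFin (code ∘ v) j)) (decode-code (v j))

  codeᵥ-injective : ∀ {n} {v w : Vec n} → codeᵥ v ≡ codeᵥ w → v ≋ w
  codeᵥ-injective {v = v} {w} eq j =
    trans (sym (decode-codeᵥ v j)) (trans (cong (λ i → decodeᵥ i j) eq) (decode-codeᵥ w j))

  funToFin-cong : ∀ {m n} {f g : Fin m → Fin n} → f ≗ g → funToFin f ≡ funToFin g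
  funToFin-cong {zero}  _   = refl
  funToFin-cong {suc m} f≗g = cong₂ Fin.combine (f≗g zero) (funToFin-cong (f≗g ∘ suc))

  decodeᵥ-injective : ∀ {n} {i j : Fin (q ^ n)} → decodeᵥ {n} i ≋ decodeᵥ j → i ≡ j
  decodeᵥ-injective {n} {i} {j} eq = begin
    i                             ≡⟨ Finₚ.funToFin-finToFin {n} i ⟨
    funToFin {n} (finToFun i)     ≡⟨ funToFin-cong (λ l → lookup-injective elements-unique _ _ (eq l)) ⟩
    funToFin {n} (finToFun j)     ≡⟨ Finₚ.funToFin-finToFin {n} j ⟩
    j                             ∎
    where open ≡-Reasoning

  -- A search through the `q ^ n` codes. Decoding returns a vector only up to pointwise equality, so
  -- the predicate has to respect `≋`.
  any-vec? : ∀ {n} {P : Vec n → Set} → (∀ {v w} → v ≋ w → P v → P w) →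
             (∀ v → Dec (P v)) → Dec (Σ[ v ∈ Vec n ] P v)
  any-vec? resp-≋ P? = map′ (λ (i , p) → decodeᵥ i , p)
                          (λ (v , p) → codeᵥ v , resp-≋ (sym ∘ decode-codeᵥ v) p)
                          (Finₚ.any? (P? ∘ decodeᵥ))

  _≟ᵥ_ : ∀ {n} (v w : Vec n) → Dec (v ≋ w)
  v ≟ᵥ w = Finₚ.all? (λ j → v j ≟F w j)

  -- Counting: an injection sends `q ^ m` points into `q ^ n`, and `q > 1` makes the power strictly
  -- increasing in its exponent.
  injective⇒dim≤ : ∀ {m n} (f : Vec m → Vec n) → (∀ {v w} → f v ≋ f w → v ≋ w) → m ≤ n
  injective⇒dim≤ {m} {n} f inj = ℕₚ.≮⇒≥ λ n<m →
    ℕₚ.<⇒≱ (ℕₚ.^-monoʳ-< q 1<q n<m)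
      (Finₚ.injective⇒≤ {f = codeᵥ ∘ f ∘ decodeᵥ {m}} (decodeᵥ-injective ∘ inj ∘ codeᵥ-injective))

  ∑-cong : ∀ {n} {f g : Fin n → Carrier} → f ≗ g → ∑ f ≡ ∑ g
  ∑-cong {zero}  _   = refl
  ∑-cong {suc n} f≗g = cong₂ _+F_ (f≗g zero) (∑-cong (f≗g ∘ suc))

  ∑-zero : ∀ n → ∑ {n} (λ _ → 0F) ≡ 0F
  ∑-zero zero    = refl
  ∑-zero (suc n) = trans (+-identityˡ _) (∑-zero n)

  ∑-distrib-+ : ∀ {n} (f g : Fin n → Carrier) → ∑ (λ i → f i +F g i) ≡ ∑ f +F ∑ g
  ∑-distrib-+ {zero}  f g = sym (+-identityˡ 0F)
  ∑-distrib-+ {suc n} f g = trans (cong (f zero +F g zero +F_) (∑-distrib-+ (f ∘ suc) (g ∘ suc))) (+-interchange _ _ _ _)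

  *-distribˡ-∑ : ∀ {n} s (f : Fin n → Carrier) → s *F ∑ f ≡ ∑ (λ i → s *F f i)
  *-distribˡ-∑ {zero}  s f = zeroʳ s
  *-distribˡ-∑ {suc n} s f = trans (distribˡ s _ _) (cong (s *F f zero +F_) (*-distribˡ-∑ s (f ∘ suc)))

  ∑-comm : ∀ {m n} (f : Fin m → Fin n → Carrier) → ∑ (λ i → ∑ (f i)) ≡ ∑ (λ j → ∑ (λ i → f i j))
  ∑-comm {zero}  {n} f = sym (∑-zero n)
  ∑-comm {suc m} {n} f = trans (cong (∑ (f zero) +F_) (∑-comm (f ∘ suc))) (sym (∑-distrib-+ (f zero) _))

  ∑-split : ∀ m {n} (f : Fin (m + n) → Carrier) → ∑ f ≡ ∑ (f ∘ (_↑ˡ n)) +F ∑ (f ∘ (m ↑ʳ_))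
  ∑-split zero    f = sym (+-identityˡ _)
  ∑-split (suc m) f = trans (cong (f zero +F_) (∑-split m (f ∘ suc))) (sym (+-assoc _ _ _))

  δ-≡ : ∀ {n} (i j : Fin n) → toℕ i ≡ toℕ j → δ i j ≡ 1F
  δ-≡ i j eq with toℕ i ℕ.≟ toℕ j
  ... | yes _ = refl
  ... | no i≢j = contradiction eq i≢j

  δ-≢ : ∀ {n} (i j : Fin n) → ¬ (toℕ i ≡ toℕ j) → δ i j ≡ 0F
  δ-≢ i j i≢j with toℕ i ℕ.≟ toℕ j
  ... | yes eq = contradiction eq i≢j
  ... | no _ = refl

  δ-suc : ∀ {n} (i j : Fin n) → δ (suc i) (suc j) ≡ δ i j
  δ-suc i j with toℕ i ℕ.≟ toℕ j
  ... | yes eq = δ-≡ (suc i) (suc j) (cong suc eq)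
  ... | no i≢j = δ-≢ (suc i) (suc j) (i≢j ∘ ℕₚ.suc-injective)

  ∑-δˡ : ∀ {n} (i : Fin n) (f : Fin n → Carrier) → ∑ (λ l → δ i l *F f l) ≡ f i
  ∑-δˡ {suc n} zero f = begin
    1F *F f zero +F ∑ (λ l → 0F *F f (suc l))  ≡⟨ cong₂ _+F_ (*-identityˡ _) (trans (∑-cong (zeroˡ ∘ f ∘ suc)) (∑-zero n)) ⟩
    f zero +F 0F                              ≡⟨ +-identityʳ _ ⟩
    f zero                                    ∎
    where open ≡-Reasoning
  ∑-δˡ (suc i) f = begin
    0F *F f zero +F ∑ (λ l → δ (suc i) (suc l) *F f (suc l))
      ≡⟨ cong₂ _+F_ (zeroˡ _) (∑-cong (λ l → cong (_*F f (suc l)) (δ-suc i l))) ⟩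
    0F +F ∑ (λ l → δ i l *F f (suc l))  ≡⟨ +-identityˡ _ ⟩
    ∑ (λ l → δ i l *F f (suc l))        ≡⟨ ∑-δˡ i (f ∘ suc) ⟩
    f (suc i)                           ∎
    where open ≡-Reasoning

  δ-sym : ∀ {n} (i j : Fin n) → δ i j ≡ δ j i
  δ-sym i j with toℕ i ℕ.≟ toℕ j
  ... | yes eq = sym (δ-≡ j i (sym eq))
  ... | no i≢j = sym (δ-≢ j i (i≢j ∘ sym))

  ·ᵥ-cong : ∀ {m n} {c d : Vec m} {A B : Mat m n} → c ≋ d → A ≈ₘ B → c ·ᵥ A ≋ d ·ᵥ B
  ·ᵥ-cong c≋d A≈B j = ∑-cong (λ i → cong₂ _*F_ (c≋d i) (A≈B i j))

  ·ᵥ-congˡ : ∀ {m n} {c d : Vec m} (A : Mat m n) → c ≋ d → c ·ᵥ A ≋ d ·ᵥ A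
  ·ᵥ-congˡ A c≋d = ·ᵥ-cong {A = A} c≋d (λ _ _ → refl)

  ·ᵥ-congʳ : ∀ {m n} (c : Vec m) {A B : Mat m n} → A ≈ₘ B → c ·ᵥ A ≋ c ·ᵥ B
  ·ᵥ-congʳ c = ·ᵥ-cong {c = c} (λ _ → refl)

  ·ᵥ-zeroˡ : ∀ {m n} (A : Mat m n) → 0ᵥ ·ᵥ A ≋ 0ᵥ
  ·ᵥ-zeroˡ {m} A j = trans (∑-cong (λ i → zeroˡ (A i j))) (∑-zero m)

  ·ᵥ-distrib-⊕ : ∀ {m n} (c d : Vec m) (A : Mat m n) → (c ⊕ d) ·ᵥ A ≋ c ·ᵥ A ⊕ d ·ᵥ A
  ·ᵥ-distrib-⊕ c d A j = trans (∑-cong (λ i → distribʳ (A i j) (c i) (d i))) (∑-distrib-+ (λ i → c i *F A i j) _)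

  ·ᵥ-⊙ : ∀ {m n} s (c : Vec m) (A : Mat m n) → (s ⊙ c) ·ᵥ A ≋ s ⊙ (c ·ᵥ A)
  ·ᵥ-⊙ s c A j = trans (∑-cong (λ i → *-assoc s (c i) (A i j))) (sym (*-distribˡ-∑ s (λ i → c i *F A i j)))

  ·ᵥ-⊖ : ∀ {m n} (c : Vec m) (A : Mat m n) → (⊖ c) ·ᵥ A ≋ ⊖ (c ·ᵥ A)
  ·ᵥ-⊖ c A j = begin
    ((⊖ c) ·ᵥ A) j            ≡⟨ ·ᵥ-congˡ A (λ i → sym (-1*x≈-x (c i))) j ⟩
    ((-F 1F ⊙ c) ·ᵥ A) j      ≡⟨ ·ᵥ-⊙ (-F 1F) c A j ⟩
    -F 1F *F (c ·ᵥ A) j       ≡⟨ -1*x≈-x _ ⟩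
    -F (c ·ᵥ A) j             ∎
    where open ≡-Reasoning

  ·ᵥ-assoc : ∀ {l m n} (c : Vec l) (A : Mat l m) (B : Mat m n) → (c ·ᵥ A) ·ᵥ B ≋ c ·ᵥ (A ·ₘ B)
  ·ᵥ-assoc c A B j = begin
    ∑ (λ i → ∑ (λ l → c l *F A l i) *F B i j)
      ≡⟨ ∑-cong (λ i → trans (*-comm _ _) (*-distribˡ-∑ (B i j) (λ l → c l *F A l i))) ⟩
    ∑ (λ i → ∑ (λ l → B i j *F (c l *F A l i)))
      ≡⟨ ∑-comm (λ i l → B i j *F (c l *F A l i)) ⟩
    ∑ (λ l → ∑ (λ i → B i j *F (c l *F A l i)))
      ≡⟨ ∑-cong (λ l → ∑-cong (λ i → trans (*-comm _ _) (*-assoc (c l) (A l i) (B i j)))) ⟩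
    ∑ (λ l → ∑ (λ i → c l *F (A l i *F B i j)))
      ≡⟨ ∑-cong (λ l → sym (*-distribˡ-∑ (c l) (λ i → A l i *F B i j))) ⟩
    ∑ (λ l → c l *F ∑ (λ i → A l i *F B i j)) ∎
    where open ≡-Reasoning

  ·ᵥ-identity : ∀ {n} (c : Vec n) → c ·ᵥ I ≋ c
  ·ᵥ-identity c j =
    trans (∑-cong (λ i → trans (*-comm _ _) (cong (_*F c i) (δ-sym i j)))) (∑-δˡ j c)

  δ-·ᵥ : ∀ {m n} (i : Fin m) (A : Mat m n) → δ i ·ᵥ A ≋ A i
  δ-·ᵥ i A j = ∑-δˡ i (λ l → A l j)

  ·ᵥ-++ : ∀ {m m′ n} (c : Vec (m + m′)) (A : Mat m n) (B : Mat m′ n) →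
          c ·ᵥ (A ++ B) ≋ (c ∘ (_↑ˡ m′)) ·ᵥ A ⊕ (c ∘ (m ↑ʳ_)) ·ᵥ B
  ·ᵥ-++ {m} {m′} c A B j = trans (∑-split m _) (cong₂ _+F_
    (∑-cong (λ i → cong (λ r → c (i ↑ˡ m′) *F r j) (lookup-++ˡ A B i)))
    (∑-cong (λ i → cong (λ r → c (m ↑ʳ i) *F r j) (lookup-++ʳ A B i))))

  ⊕-⊖ : ∀ {n} (v w : Vec n) → v ≋ w → v ⊕ ⊖ w ≋ 0ᵥ
  ⊕-⊖ v w v≋w j = trans (cong (_+F -F w j) (v≋w j)) (-‿inverseʳ (w j))

  record Linear {m n} (f : Vec m → Vec n) : Set where
    field
      resp-≋ : ∀ {v w} → v ≋ w → f v ≋ f w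
      add  : ∀ v w → f (v ⊕ w) ≋ f v ⊕ f w
      neg  : ∀ v → f (⊖ v) ≋ ⊖ f v

    injective : (∀ v → f v ≋ 0ᵥ → v ≋ 0ᵥ) → ∀ {v w} → f v ≋ f w → v ≋ w
    injective ker {v} {w} fv≋fw j = x-y≡0⇒x≡y _ _ (ker (v ⊕ ⊖ w) (λ i → begin
      f (v ⊕ ⊖ w) i           ≡⟨ add v (⊖ w) i ⟩
      f v i +F f (⊖ w) i      ≡⟨ cong (f v i +F_) (neg w i) ⟩
      f v i +F -F f w i       ≡⟨ ⊕-⊖ (f v) (f w) fv≋fw i ⟩
      0F                      ∎) j)
      where open ≡-Reasoning

  ·ᵥ-linear : ∀ {m n} (A : Mat m n) → Linear (_·ᵥ A)
  ·ᵥ-linear A = record { resp-≋ = ·ᵥ-congˡ A; add = λ v w → ·ᵥ-distrib-⊕ v w A; neg = λ v → ·ᵥ-⊖ v A }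

  ·ᵥ-injective : ∀ {m n} {A : Mat m n} → LinIndepRows A → ∀ {c d} → c ·ᵥ A ≋ d ·ᵥ A → c ≋ d
  ·ᵥ-injective {A = A} indep = Linear.injective (·ᵥ-linear A) indep

  -- A `Subspace` is an arbitrary predicate, so even stability under pointwise equality has to be
  -- recorded. Nonemptiness is kept apart: `combination` takes the zero vector as an argument, for
  -- the empty sum.
  record Closed {n} (P : Subspace n) : Set where
    field
      resp-≋  : ∀ {v w} → v ≋ w → P v → P w
      add   : ∀ {v w} → P v → P w → P (v ⊕ w)
      scale : ∀ s {v} → P v → P (s ⊙ v)

    neg : ∀ {v} → P v → P (⊖ v)
    neg {v} p = resp-≋ (λ j → -1*x≈-x (v j)) (scale (-F 1F) p)

    combination : P 0ᵥ → ∀ {m} (c : Vec m) (A : Mat m n) → (∀ i → P (A i)) → P (c ·ᵥ A)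
    combination p₀ {zero}  c A rows = p₀
    combination p₀ {suc m} c A rows = add (scale (c zero) (rows zero)) (combination p₀ (tail c) (tail A) (rows ∘ suc))

  rowsp-closed : ∀ {m n} (A : Mat m n) → Closed (InRowsp A)
  rowsp-closed A = record
    { resp-≋  = λ v≋w (c , eq) → c , λ j → trans (sym (v≋w j)) (eq j)
    ; add   = λ (c , eq) (d , eq′) → c ⊕ d , λ j → trans (cong₂ _+F_ (eq j) (eq′ j)) (sym (·ᵥ-distrib-⊕ c d A j))
    ; scale = λ s (c , eq) → s ⊙ c , λ j → trans (cong (s *F_) (eq j)) (sym (·ᵥ-⊙ s c A j))
    }

  rowsp-row : ∀ {m n} (A : Mat m n) i → InRowsp A (A i)
  rowsp-row A i = δ i , λ j → sym (δ-·ᵥ i A j)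

  rowsp-null : ∀ {m n} (A : Mat m n) → InRowsp A 0ᵥ
  rowsp-null A = 0ᵥ , λ j → sym (·ᵥ-zeroˡ A j)

  rowsp-⊆ : ∀ {m n} {P : Subspace n} (A : Mat m n) → Closed P → P 0ᵥ → (∀ i → P (A i)) → InRowsp A ⊆ˢ P
  rowsp-⊆ A P-closed p₀ rows v (c , eq) =
    Closed.resp-≋ P-closed (sym ∘ eq) (Closed.combination P-closed p₀ c A rows)

  closed-≐ : ∀ {n} {P Q : Subspace n} → P ≐ˢ Q → Closed Q → Closed P
  closed-≐ (P⊆Q , Q⊆P) Q-closed = record
    { resp-≋  = λ eq p → Q⊆P _ (resp-≋ eq (P⊆Q _ p))
    ; add   = λ p p′ → Q⊆P _ (add (P⊆Q _ p) (P⊆Q _ p′))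
    ; scale = λ s p → Q⊆P _ (scale s (P⊆Q _ p))
    }
    where open Closed Q-closed

  dim⇒closed : ∀ {n d} {P : Subspace n} → HasDim P d → Closed P
  dim⇒closed (B , _ , P≐B) = closed-≐ P≐B (rowsp-closed B)

  ≐-sym : ∀ {n} {P Q : Subspace n} → P ≐ˢ Q → Q ≐ˢ P
  ≐-sym (P⊆Q , Q⊆P) = Q⊆P , P⊆Q

  ≐-trans : ∀ {n} {P Q R : Subspace n} → P ≐ˢ Q → Q ≐ˢ R → P ≐ˢ R
  ≐-trans (P⊆Q , Q⊆P) (Q⊆R , R⊆Q) = (λ v → Q⊆R v ∘ P⊆Q v) , (λ v → Q⊆P v ∘ R⊆Q v)

  dim-≐ : ∀ {n d} {P Q : Subspace n} → P ≐ˢ Q → HasDim P d → HasDim Q d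
  dim-≐ P≐Q (B , indep , P≐B) = B , indep , ≐-trans (≐-sym P≐Q) P≐B

  inRowsp? : ∀ {m n} (A : Mat m n) v → Dec (InRowsp A v)
  inRowsp? A v = any-vec? (λ c≋d eq j → trans (eq j) (·ᵥ-congˡ A c≋d j)) (λ c → v ≟ᵥ (c ·ᵥ A))

  -- With the basis of `P` written as `X ·ₘ C` in the basis `C` of `Q`, a relation among the rows of
  -- `X` is one among the basis vectors of `P`. Hence `_·ᵥ X` is injective, and counting bounds `d`
  -- by `e`.
  dim-mono : ∀ {n d e} {P Q : Subspace n} → HasDim P d → HasDim Q e → P ⊆ˢ Q → d ≤ e
  dim-mono (B , B-indep , _ , B⊆P) (C , _ , Q⊆C , _) P⊆Q =
    injective⇒dim≤ (_·ᵥ X) (Linear.injective (·ᵥ-linear X) λ c cX≋0 → B-indep c λ j → begin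
      (c ·ᵥ B) j         ≡⟨ ·ᵥ-congʳ c B≈XC j ⟩
      (c ·ᵥ (X ·ₘ C)) j  ≡⟨ ·ᵥ-assoc c X C j ⟨
      (c ·ᵥ X ·ᵥ C) j    ≡⟨ ·ᵥ-congˡ C cX≋0 j ⟩
      (0ᵥ ·ᵥ C) j        ≡⟨ ·ᵥ-zeroˡ C j ⟩
      0F                 ∎)
    where
    open ≡-Reasoning
    inC : ∀ i → InRowsp C (B i)
    inC i = Q⊆C _ (P⊆Q _ (B⊆P _ (rowsp-row B i)))
    X : Mat _ _
    X i = proj₁ (inC i)
    B≈XC : B ≈ₘ (X ·ₘ C)
    B≈XC i = proj₂ (inC i)

  dim-unique : ∀ {n d e} {P Q : Subspace n} → HasDim P d → HasDim Q e → P ≐ˢ Q → d ≡ e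
  dim-unique dP dQ (P⊆Q , Q⊆P) = ℕₚ.≤-antisym (dim-mono dP dQ P⊆Q) (dim-mono dQ dP Q⊆P)

-- Rank and nullity, sums and intersections, invertible matrices.

module Dimension (F : FiniteField) where
  open LinearAlgebra F public

  Ker : ∀ {m n} → Mat m n → Subspace m
  Ker A c = c ·ᵥ A ≋ 0ᵥ

  ker-closed : ∀ {m n} (A : Mat m n) → Closed (Ker A)
  ker-closed A = record
    { resp-≋ = λ {_} {_} v≋w eq j → trans (sym (·ᵥ-congˡ A v≋w j)) (eq j)
    ; add    = λ {v} {w} eq eq′ j → begin
        ((v ⊕ w) ·ᵥ A) j           ≡⟨ ·ᵥ-distrib-⊕ v w A j ⟩
        (v ·ᵥ A) j +F (w ·ᵥ A) j   ≡⟨ cong₂ _+F_ (eq j) (eq′ j) ⟩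
        0F +F 0F                   ≡⟨ +-identityˡ 0F ⟩
        0F                         ∎
    ; scale  = λ s {v} eq j → trans (·ᵥ-⊙ s v A j) (trans (cong (s *F_) (eq j)) (zeroʳ s))
    }
    where open ≡-Reasoning

  cancel-scalar : ∀ {n} {P : Subspace n} → Closed P → ∀ {s v} → ¬ (s ≡ 0F) → P (s ⊙ v) → P v
  cancel-scalar P-closed {s} {v} s≢0 p = resp-≋ eq (scale s⁻¹ p)
    where
    open Closed P-closed
    open ≡-Reasoning
    s⁻¹ = proj₁ (inverse s s≢0)
    eq : s⁻¹ ⊙ (s ⊙ v) ≋ v
    eq j = begin
      s⁻¹ *F (s *F v j)    ≡⟨ *-assoc s⁻¹ s (v j) ⟨
      s⁻¹ *F s *F v j      ≡⟨ cong (_*F v j) (trans (*-comm s⁻¹ s) (proj₂ (inverse s s≢0))) ⟩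
      1F *F v j            ≡⟨ *-identityˡ (v j) ⟩
      v j                  ∎

  closed-cancelˡ : ∀ {n} {P : Subspace n} → Closed P → ∀ {s v w} → ¬ (s ≡ 0F) →
                   s ⊙ v ⊕ w ≋ 0ᵥ → P w → P v
  closed-cancelˡ P-closed {s} {v} {w} s≢0 eq pw =
    cancel-scalar P-closed s≢0 (resp-≋ (λ j → sym (x+y≡0⇒x≡-y _ _ (eq j))) (neg pw))
    where open Closed P-closed

  indep-∷ : ∀ {m n} {B : Mat m n} {v} → LinIndepRows B → ¬ InRowsp B v → LinIndepRows (v ∷ B)
  indep-∷ {B = B} {v} indep v∉B d eq with d zero ≟F 0F
  ... | no d₀≢0 = contradiction (closed-cancelˡ (rowsp-closed B) d₀≢0 eq (tail d , λ _ → refl)) v∉B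
  ... | yes d₀≡0 = λ
    { zero    → d₀≡0
    ; (suc i) → indep (tail d) (λ j → begin
        (tail d ·ᵥ B) j                    ≡⟨ +-identityˡ _ ⟨
        0F +F (tail d ·ᵥ B) j              ≡⟨ cong (_+F (tail d ·ᵥ B) j) (zeroˡ (v j)) ⟨
        0F *F v j +F (tail d ·ᵥ B) j       ≡⟨ cong (λ s → s *F v j +F (tail d ·ᵥ B) j) d₀≡0 ⟨
        d zero *F v j +F (tail d ·ᵥ B) j   ≡⟨ eq j ⟩
        0F                                 ∎) i
    }
    where open ≡-Reasoning

  rowsp-∷-mono : ∀ {m m′ n} {A : Mat m n} {B : Mat m′ n} {v} → InRowsp A ⊆ˢ InRowsp B → InRowsp (v ∷ A) ⊆ˢ InRowsp (v ∷ B)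
  rowsp-∷-mono {A = A} {B} {v} A⊆B = rowsp-⊆ (v ∷ A) (rowsp-closed (v ∷ B)) (rowsp-null (v ∷ B)) λ
    { zero    → rowsp-row (v ∷ B) zero
    ; (suc i) → rowsp-⊆ B (rowsp-closed (v ∷ B)) (rowsp-null (v ∷ B)) (rowsp-row (v ∷ B) ∘ suc) _ (A⊆B _ (rowsp-row A i))
    }

  rowsp-∷-absorb : ∀ {m n} {A : Mat m n} {v} → InRowsp A v → InRowsp (v ∷ A) ≐ˢ InRowsp A
  rowsp-∷-absorb {A = A} {v} v∈A =
    rowsp-⊆ (v ∷ A) (rowsp-closed A) (rowsp-null A) (λ { zero → v∈A ; (suc i) → rowsp-row A i }) ,
    rowsp-⊆ A (rowsp-closed (v ∷ A)) (rowsp-null (v ∷ A)) (rowsp-row (v ∷ A) ∘ suc)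

  ∷-η : ∀ {m n} (A : Mat (suc m) n) → InRowsp A ≐ˢ InRowsp (A zero ∷ tail A)
  ∷-η A = (λ _ → id) , (λ _ → id)

  ·ᵥ-0∷ : ∀ {t m} (d : Vec t) (K : Mat t m) → d ·ᵥ (λ i → 0F ∷ K i) ≋ (0F ∷ d ·ᵥ K)
  ·ᵥ-0∷ {t} d K zero    = trans (∑-cong (zeroʳ ∘ d)) (∑-zero t)
  ·ᵥ-0∷     d K (suc j) = refl

  indep-0∷ : ∀ {t m} {K : Mat t m} → LinIndepRows K → LinIndepRows (λ i → 0F ∷ K i)
  indep-0∷ indep d eq = indep d (eq ∘ suc)

  -- Induction on the rows. If the top row is a combination `c` of the others, the rank stays and
  -- the left kernel gains `(1, −c)`; otherwise the rank grows and each relation has top coefficient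
  -- 0.
  rank-nullity : ∀ {m n} (A : Mat m n) →
    Σ[ r ∈ ℕ ] Σ[ t ∈ ℕ ] (r + t ≡ m × HasDim (InRowsp A) r × HasDim (Ker A) t)
  rank-nullity {zero} A =
    0 , 0 , refl ,
    (A , (λ _ _ ()) , (λ _ → id) , (λ _ → id)) ,
    ((λ ()) , (λ _ _ ()) , (λ _ _ → (λ ()) , λ ()) , (λ _ _ _ → refl))
  rank-nullity {suc m} A with rank-nullity (tail A) | inRowsp? (tail A) (A zero)
  ... | r , t , r+t≡m , dimA′ , K , K-indep , Ker⊆K , K⊆Ker | yes A₀∈A′@(c , A₀≋cA′) =
    r , suc t , trans (ℕₚ.+-suc r t) (cong suc r+t≡m) ,
    dim-≐ (≐-trans (≐-sym (rowsp-∷-absorb A₀∈A′)) (≐-sym (∷-η A))) dimA′ ,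
    (r₀ ∷ K₀ , indep-∷ (indep-0∷ {K = K} K-indep) r₀∉ , ⊆ , rowsp-⊆ (r₀ ∷ K₀) (ker-closed A) (·ᵥ-zeroˡ A) rows)
    where
    open ≡-Reasoning
    r₀ : Vec (suc m)
    r₀ = 1F ∷ ⊖ c
    K₀ : Mat t (suc m)
    K₀ i = 0F ∷ K i
    r₀∉ : ¬ InRowsp K₀ r₀
    r₀∉ (d , eq) = 0≢1 (trans (sym (·ᵥ-0∷ d K zero)) (sym (eq zero)))
    rows : ∀ i → Ker A ((r₀ ∷ K₀) i)
    rows zero j = begin
      1F *F A zero j +F ((⊖ c) ·ᵥ tail A) j   ≡⟨ cong₂ _+F_ (*-identityˡ _) (·ᵥ-⊖ c (tail A) j) ⟩
      A zero j +F -F (c ·ᵥ tail A) j          ≡⟨ ⊕-⊖ (A zero) (c ·ᵥ tail A) A₀≋cA′ j ⟩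
      0F                                      ∎
    rows (suc i) j = begin
      0F *F A zero j +F (K i ·ᵥ tail A) j     ≡⟨ cong₂ _+F_ (zeroˡ _) (K⊆Ker (K i) (rowsp-row K i) j) ⟩
      0F +F 0F                                ≡⟨ +-identityˡ 0F ⟩
      0F                                      ∎
    ⊆ : Ker A ⊆ˢ InRowsp (r₀ ∷ K₀)
    -- Subtracting `x zero ⊙ r₀` from `x` clears its top coordinate and leaves
    -- `tail x ⊕ x zero ⊙ c`, a relation among the lower rows.
    ⊆ x x∈Ker = x zero ∷ proj₁ e , λ { zero → eq₀ ; (suc j) → eqₛ j }
      where
      e : InRowsp K (tail x ⊕ x zero ⊙ c)
      e = Ker⊆K _ λ j → begin
        ((tail x ⊕ x zero ⊙ c) ·ᵥ tail A) j                   ≡⟨ ·ᵥ-distrib-⊕ (tail x) (x zero ⊙ c) (tail A) j ⟩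
        (tail x ·ᵥ tail A) j +F ((x zero ⊙ c) ·ᵥ tail A) j    ≡⟨ cong ((tail x ·ᵥ tail A) j +F_) (·ᵥ-⊙ (x zero) c (tail A) j) ⟩
        (tail x ·ᵥ tail A) j +F x zero *F (c ·ᵥ tail A) j     ≡⟨ cong (λ z → (tail x ·ᵥ tail A) j +F x zero *F z) (A₀≋cA′ j) ⟨
        (tail x ·ᵥ tail A) j +F x zero *F A zero j            ≡⟨ +-comm _ _ ⟩
        x zero *F A zero j +F (tail x ·ᵥ tail A) j            ≡⟨ x∈Ker j ⟩
        0F                                                    ∎
      eq₀ : x zero ≡ x zero *F 1F +F (proj₁ e ·ᵥ K₀) zero
      eq₀ = sym (trans (cong₂ _+F_ (*-identityʳ _) (·ᵥ-0∷ (proj₁ e) K zero)) (+-identityʳ _))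
      eqₛ : ∀ j → x (suc j) ≡ x zero *F -F c j +F (proj₁ e ·ᵥ K) j
      eqₛ j = begin
        x (suc j)                                               ≡⟨ +-identityˡ _ ⟨
        0F +F x (suc j)                                         ≡⟨ cong (_+F x (suc j)) (-‿inverseˡ (x zero *F c j)) ⟨
        -F (x zero *F c j) +F x zero *F c j +F x (suc j)        ≡⟨ +-assoc _ _ _ ⟩
        -F (x zero *F c j) +F (x zero *F c j +F x (suc j))      ≡⟨ cong₂ _+F_ (-‿distribʳ-* _ _) (+-comm _ _) ⟩
        x zero *F -F c j +F (x (suc j) +F x zero *F c j)        ≡⟨ cong (x zero *F -F c j +F_) (proj₂ e j) ⟩
        x zero *F -F c j +F (proj₁ e ·ᵥ K) j                    ∎
  ... | r , t , r+t≡m , (B , B-indep , A′⊆B , B⊆A′) , K , K-indep , Ker⊆K , K⊆Ker | no A₀∉A′ =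
    suc r , t , cong suc r+t≡m ,
    dim-≐ (≐-sym (∷-η A)) (A zero ∷ B , indep-∷ B-indep (A₀∉A′ ∘ B⊆A′ _) , rowsp-∷-mono A′⊆B , rowsp-∷-mono B⊆A′) ,
    (K₀ , indep-0∷ {K = K} K-indep , ⊆ , rowsp-⊆ K₀ (ker-closed A) (·ᵥ-zeroˡ A) rows)
    where
    open ≡-Reasoning
    K₀ : Mat t (suc m)
    K₀ i = 0F ∷ K i
    rows : ∀ i → Ker A (K₀ i)
    rows i j = begin
      0F *F A zero j +F (K i ·ᵥ tail A) j     ≡⟨ cong₂ _+F_ (zeroˡ _) (K⊆Ker (K i) (rowsp-row K i) j) ⟩
      0F +F 0F                                ≡⟨ +-identityˡ 0F ⟩
      0F                                      ∎
    ⊆ : Ker A ⊆ˢ InRowsp K₀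
    ⊆ x x∈Ker with x zero ≟F 0F
    -- Dividing the relation by a nonzero top coefficient would put the top row into the span of the
    -- others.
    ... | no x₀≢0 = contradiction (closed-cancelˡ (rowsp-closed (tail A)) x₀≢0 x∈Ker (tail x , λ _ → refl)) A₀∉A′
    ... | yes x₀≡0 = proj₁ e , λ { zero → trans x₀≡0 (sym (·ᵥ-0∷ (proj₁ e) K zero)) ; (suc j) → proj₂ e j }
      where
      e : InRowsp K (tail x)
      e = Ker⊆K _ λ j → begin
        (tail x ·ᵥ tail A) j                         ≡⟨ +-identityˡ _ ⟨
        0F +F (tail x ·ᵥ tail A) j                   ≡⟨ cong (_+F (tail x ·ᵥ tail A) j) (zeroˡ (A zero j)) ⟨
        0F *F A zero j +F (tail x ·ᵥ tail A) j       ≡⟨ cong (λ s → s *F A zero j +F (tail x ·ᵥ tail A) j) x₀≡0 ⟨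
        x zero *F A zero j +F (tail x ·ᵥ tail A) j   ≡⟨ x∈Ker j ⟩
        0F                                           ∎

  rowsp-++ : ∀ {p p′ n} {B : Mat p n} {C : Mat p′ n} → InRowsp (B ++ C) ≐ˢ (InRowsp B +ˢ InRowsp C)
  rowsp-++ {p} {p′} {B = B} {C} =
    (λ v (c , eq) → _ , _ , (c ∘ (_↑ˡ p′) , λ _ → refl) , (c ∘ (p ↑ʳ_) , λ _ → refl) ,
      λ j → trans (eq j) (·ᵥ-++ c B C j)) ,
    (λ v (a , b , (c , a≋cB) , (d , b≋dC) , v≋a⊕b) → c ++ d , λ j → begin
      v j                       ≡⟨ v≋a⊕b j ⟩
      a j +F b j                ≡⟨ cong₂ _+F_ (a≋cB j) (b≋dC j) ⟩
      (c ·ᵥ B) j +F (d ·ᵥ C) j  ≡⟨ cong₂ _+F_ (·ᵥ-congˡ B (lookup-++ˡ c d) j) (·ᵥ-congˡ C (lookup-++ʳ c d) j) ⟨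
      (((c ++ d) ∘ (_↑ˡ p′)) ·ᵥ B) j +F (((c ++ d) ∘ (p ↑ʳ_)) ·ᵥ C) j  ≡⟨ ·ᵥ-++ (c ++ d) B C j ⟨
      ((c ++ d) ·ᵥ (B ++ C)) j  ∎)
    where open ≡-Reasoning

  ++-0 : ∀ {m n} (c : Vec (m + n)) → c ∘ (_↑ˡ n) ≋ 0ᵥ → c ∘ (m ↑ʳ_) ≋ 0ᵥ → c ≋ 0ᵥ
  ++-0 {m} {n} c l r j = trans (cong c (sym (Finₚ.join-splitAt m n j))) (go (splitAt m j))
    where
    go : ∀ s → c (Fin.join m n s) ≡ 0F
    go (inj₁ i) = l i
    go (inj₂ i) = r i

  +ˢ-cong : ∀ {n} {P P′ Q Q′ : Subspace n} → P ≐ˢ P′ → Q ≐ˢ Q′ → (P +ˢ Q) ≐ˢ (P′ +ˢ Q′)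
  +ˢ-cong (P⊆ , ⊆P) (Q⊆ , ⊆Q) =
    (λ v (a , b , p , q , eq) → a , b , P⊆ a p , Q⊆ b q , eq) ,
    (λ v (a , b , p , q , eq) → a , b , ⊆P a p , ⊆Q b q , eq)

  ∩ˢ-cong : ∀ {n} {P P′ Q Q′ : Subspace n} → P ≐ˢ P′ → Q ≐ˢ Q′ → (P ∩ˢ Q) ≐ˢ (P′ ∩ˢ Q′)
  ∩ˢ-cong (P⊆ , ⊆P) (Q⊆ , ⊆Q) = (λ v (p , q) → P⊆ v p , Q⊆ v q) , (λ v (p , q) → ⊆P v p , ⊆Q v q)

  -- P ∩ Q is the image of the left kernel of the two stacked bases.
  dim-+-∩ : ∀ {n d e} {P Q : Subspace n} → HasDim P d → HasDim Q e →
    Σ[ s ∈ ℕ ] Σ[ t ∈ ℕ ] (s + t ≡ d + e × HasDim (P +ˢ Q) s × HasDim (P ∩ˢ Q) t)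
  dim-+-∩ {n} {d} {e} {P} {Q} (B , B-indep , P≐B) (C , C-indep , Q≐C)
    with rank-nullity (B ++ C)
  ... | s , t , s+t≡d+e , dim+ , K , K-indep , Ker⊆K , K⊆Ker =
    s , t , s+t≡d+e ,
    dim-≐ (≐-trans rowsp-++ (+ˢ-cong (≐-sym P≐B) (≐-sym Q≐C))) dim+ ,
    dim-≐ (∩ˢ-cong (≐-sym P≐B) (≐-sym Q≐C)) (D , D-indep , ∩⊆D , λ v → D⊆∩ v)
    where
    open ≡-Reasoning
    L : Mat t d
    L i = K i ∘ (_↑ˡ e)
    R : Mat t e
    R i = K i ∘ (d ↑ʳ_)
    D : Mat t n
    D = L ·ₘ B
    relation : ∀ c → (c ·ᵥ L) ·ᵥ B ⊕ (c ·ᵥ R) ·ᵥ C ≋ 0ᵥ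
    relation c j = trans (sym (·ᵥ-++ (c ·ᵥ K) B C j)) (K⊆Ker (c ·ᵥ K) (c , λ _ → refl) j)
    D-indep : LinIndepRows D
    D-indep c cD≋0 = K-indep c (++-0 (c ·ᵥ K) cL≋0 (C-indep (c ·ᵥ R) λ j → begin
      ((c ·ᵥ R) ·ᵥ C) j                       ≡⟨ +-identityˡ _ ⟨
      0F +F ((c ·ᵥ R) ·ᵥ C) j                 ≡⟨ cong (_+F ((c ·ᵥ R) ·ᵥ C) j) (cLB≋0 j) ⟨
      ((c ·ᵥ L) ·ᵥ B) j +F ((c ·ᵥ R) ·ᵥ C) j  ≡⟨ relation c j ⟩
      0F                                      ∎))
      where
      cLB≋0 : (c ·ᵥ L) ·ᵥ B ≋ 0ᵥ
      cLB≋0 j = trans (·ᵥ-assoc c L B j) (cD≋0 j)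
      cL≋0 : c ·ᵥ L ≋ 0ᵥ
      cL≋0 = B-indep (c ·ᵥ L) cLB≋0
    ∩⊆D : (InRowsp B ∩ˢ InRowsp C) ⊆ˢ InRowsp D
    ∩⊆D v ((x , v≋xB) , (y , v≋yC)) = proj₁ e′ , λ j → begin
      v j                        ≡⟨ v≋xB j ⟩
      (x ·ᵥ B) j                 ≡⟨ ·ᵥ-congˡ B (λ i → trans (sym (lookup-++ˡ x (⊖ y) i)) (proj₂ e′ (i ↑ˡ e))) j ⟩
      ((proj₁ e′ ·ᵥ L) ·ᵥ B) j   ≡⟨ ·ᵥ-assoc (proj₁ e′) L B j ⟩
      (proj₁ e′ ·ᵥ D) j          ∎
      where
      e′ : InRowsp K (x ++ ⊖ y)
      e′ = Ker⊆K _ λ j → begin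
        ((x ++ ⊖ y) ·ᵥ (B ++ C)) j    ≡⟨ ·ᵥ-++ (x ++ ⊖ y) B C j ⟩
        _                             ≡⟨ cong₂ _+F_ (·ᵥ-congˡ B (lookup-++ˡ x (⊖ y)) j) (·ᵥ-congˡ C (lookup-++ʳ x (⊖ y)) j) ⟩
        (x ·ᵥ B) j +F ((⊖ y) ·ᵥ C) j  ≡⟨ cong ((x ·ᵥ B) j +F_) (·ᵥ-⊖ y C j) ⟩
        (x ·ᵥ B) j +F -F (y ·ᵥ C) j   ≡⟨ ⊕-⊖ (x ·ᵥ B) (y ·ᵥ C) (λ i → trans (sym (v≋xB i)) (v≋yC i)) j ⟩
        0F                            ∎
    D⊆∩ : ∀ v → InRowsp D v → (InRowsp B ∩ˢ InRowsp C) v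
    -- A relation between the stacked bases equates its `B` half with the negative of its `C` half,
    -- so the same vector lies in both row spaces.
    D⊆∩ v (c , v≋cD) = (c ·ᵥ L , v≋) , (⊖ (c ·ᵥ R) , λ j → begin
        v j                        ≡⟨ v≋ j ⟩
        ((c ·ᵥ L) ·ᵥ B) j          ≡⟨ x+y≡0⇒x≡-y _ _ (relation c j) ⟩
        -F ((c ·ᵥ R) ·ᵥ C) j       ≡⟨ ·ᵥ-⊖ (c ·ᵥ R) C j ⟨
        ((⊖ (c ·ᵥ R)) ·ᵥ C) j      ∎)
      where
      v≋ : v ≋ (c ·ᵥ L) ·ᵥ B
      v≋ j = trans (v≋cD j) (sym (·ᵥ-assoc c L B j))

  -- `0F ≡ 0F` serves as a predicate that always holds, so it stands for the whole space.
  dim-full : ∀ n → HasDim {n} (λ _ → 0F ≡ 0F) n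
  dim-full n = I , (λ c cI≋0 i → trans (sym (·ᵥ-identity c i)) (cI≋0 i)) ,
    (λ v _ → v , λ j → sym (·ᵥ-identity v j)) , (λ _ _ → refl)

  dim≤n : ∀ {n d} {P : Subspace n} → HasDim P d → d ≤ n
  dim≤n {n} dP = dim-mono dP (dim-full n) (λ _ _ → refl)

  -- A vector outside would extend the basis to `n + 1` independent rows of length `n`.
  dim-n⇒full : ∀ {n} {P : Subspace n} → HasDim P n → ∀ v → P v
  dim-n⇒full dP@(B , B-indep , _ , B⊆P) v with inRowsp? B v
  ... | yes v∈B = B⊆P v v∈B
  ... | no v∉B  = contradiction
    (dim≤n (v ∷ B , indep-∷ B-indep v∉B , (λ _ → id) , (λ _ → id))) ℕₚ.1+n≰n

  dim-0⇒null : ∀ {n} {P : Subspace n} → HasDim P 0 → ∀ v → P v → v ≋ 0ᵥ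
  dim-0⇒null (B , _ , P⊆B , _) v p = proj₂ (P⊆B v p)

  null⇒dim-0 : ∀ {n d} {P : Subspace n} → HasDim P d → (∀ v → P v → v ≋ 0ᵥ) → d ≡ 0
  null⇒dim-0 {d = zero}  _ _ = refl
  null⇒dim-0 {d = suc d} (B , B-indep , _ , B⊆P) null =
    contradiction (trans (sym (B-indep (δ zero) (λ j → trans (δ-·ᵥ zero B j) (null _ (B⊆P _ (rowsp-row B zero)) j)) zero))
      (δ-≡ {suc d} zero zero refl)) 0≢1

  full-rank⇒indep : ∀ {m n} {A : Mat m n} → HasRank A m → LinIndepRows A
  full-rank⇒indep {m} {A = A} rank c cA≋0 with rank-nullity A
  ... | r , t , r+t≡m , dimA , dimKer with ℕₚ.+-cancelˡ-≡ m t 0 (trans (trans (cong (_+ t) (dim-unique rank dimA ((λ _ → id) , λ _ → id))) r+t≡m) (sym (ℕₚ.+-identityʳ m)))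
  ... | refl = dim-0⇒null dimKer c cA≋0

  indep⇒dim : ∀ {m n} {A : Mat m n} → LinIndepRows A → HasDim (InRowsp A) m
  indep⇒dim {A = A} indep = A , indep , (λ _ → id) , (λ _ → id)

  -- Independent rows of a square matrix span, so each unit vector is a combination of them; the
  -- coefficients form a left inverse `W`. It is a right inverse too, because `A` can be cancelled
  -- from `(A W) A = A`.
  indep⇒invertible : ∀ {n} {A : Mat n n} → LinIndepRows A → Invertible A
  indep⇒invertible {n} {A} indep = W , AW≈I , WA≈I
    where
    open ≡-Reasoning
    W : Mat n n
    W i = proj₁ (dim-n⇒full (indep⇒dim indep) (δ i))
    WA≈I : (W ·ₘ A) ≈ₘ I
    WA≈I i j = sym (proj₂ (dim-n⇒full (indep⇒dim indep) (δ i)) j)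
    AW≈I : (A ·ₘ W) ≈ₘ I
    AW≈I i = ·ᵥ-injective indep λ j → begin
      ((A i ·ᵥ W) ·ᵥ A) j   ≡⟨ ·ᵥ-assoc (A i) W A j ⟩
      (A i ·ᵥ (W ·ₘ A)) j   ≡⟨ ·ᵥ-congʳ (A i) WA≈I j ⟩
      (A i ·ᵥ I) j          ≡⟨ ·ᵥ-identity (A i) j ⟩
      A i j                 ≡⟨ δ-·ᵥ i A j ⟨
      (δ i ·ᵥ A) j          ∎

  ·ᵥ-cancel : ∀ {n} {A B : Mat n n} → (A ·ₘ B) ≈ₘ I → ∀ c → (c ·ᵥ A) ·ᵥ B ≋ c
  ·ᵥ-cancel {A = A} {B} AB≈I c j = trans (·ᵥ-assoc c A B j) (trans (·ᵥ-congʳ c AB≈I j) (·ᵥ-identity c j))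

  invertible⇒indep : ∀ {n} {A : Mat n n} → Invertible A → LinIndepRows A
  invertible⇒indep {A = A} (W , AW≈I , _) c cA≋0 j =
    trans (sym (·ᵥ-cancel {A = A} {W} AW≈I c j)) (trans (·ᵥ-congˡ W cA≋0 j) (·ᵥ-zeroˡ W j))

-- Polynomials as coefficient sequences, and the companion matrix.

module Polynomial (F : FiniteField) where
  open Dimension F public

  ∑ℕ-cong : ∀ n {f g : ℕ → Carrier} → (∀ i → i < n → f i ≡ g i) → ∑ℕ n f ≡ ∑ℕ n g
  ∑ℕ-cong zero    eq = refl
  ∑ℕ-cong (suc n) eq = cong₂ _+F_ (∑ℕ-cong n (λ i i<n → eq i (ℕₚ.m<n⇒m<1+n i<n))) (eq n ℕₚ.≤-refl)

  ∑ℕ-zero : ∀ n {f : ℕ → Carrier} → (∀ i → i < n → f i ≡ 0F) → ∑ℕ n f ≡ 0F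
  ∑ℕ-zero zero    eq = refl
  ∑ℕ-zero (suc n) eq =
    trans (cong₂ _+F_ (∑ℕ-zero n (λ i i<n → eq i (ℕₚ.m<n⇒m<1+n i<n))) (eq n ℕₚ.≤-refl)) (+-identityˡ 0F)

  -- Isolates one coefficient in a convolution; `monic-*-cancel` applies it to the leading term of
  -- the monic factor.
  ∑ℕ-cancel : ∀ n {f g : ℕ → Carrier} {m} → m < n → (∀ i → i < n → ¬ (i ≡ m) → f i ≡ g i) →
              ∑ℕ n f ≡ ∑ℕ n g → f m ≡ g m
  ∑ℕ-cancel (suc n) {f} {g} {m} (s≤s m≤n) eq sums with m ℕ.≟ n
  ... | yes refl = +-cancelˡ (∑ℕ n f) (f n) (g n) (trans sums
    (cong (_+F g n) (sym (∑ℕ-cong n (λ i i<n → eq i (ℕₚ.m<n⇒m<1+n i<n) (ℕₚ.<⇒≢ i<n))))))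
  ... | no m≢n = ∑ℕ-cancel n (ℕₚ.≤∧≢⇒< m≤n m≢n) (λ i i<n → eq i (ℕₚ.m<n⇒m<1+n i<n))
    (+-cancelʳ (f n) (∑ℕ n f) (∑ℕ n g) (trans sums (cong (∑ℕ n g +F_) (sym (eq n ℕₚ.≤-refl (m≢n ∘ sym))))))

  -- As a function of its first argument, the monomial x^e.
  χ : ℕ → ℕ → Carrier
  χ i e with i ℕ.≟ e
  ... | yes _ = 1F
  ... | no  _ = 0F

  χ-≡ : ∀ i → χ i i ≡ 1F
  χ-≡ i with i ℕ.≟ i
  ... | yes _  = refl
  ... | no i≢i = contradiction refl i≢i

  χ-≢ : ∀ {i e} → ¬ (i ≡ e) → χ i e ≡ 0F
  χ-≢ {i} {e} i≢e with i ℕ.≟ e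
  ... | yes i≡e = contradiction i≡e i≢e
  ... | no _    = refl

  χ-suc : ∀ i e → χ (suc i) (suc e) ≡ χ i e
  χ-suc i e with i ℕ.≟ e
  ... | yes refl = χ-≡ (suc i)
  ... | no i≢e   = χ-≢ (i≢e ∘ ℕₚ.suc-injective)

  xe-1≡χ : ∀ e i → xe-1 e i ≡ χ i e +F -F χ i 0
  xe-1≡χ e i with i ℕ.≟ e | i ℕ.≟ 0
  ... | yes _ | yes _ = refl
  ... | yes _ | no _  = cong (1F +F_) (sym -0≡0)
  ... | no _  | yes _ = refl
  ... | no _  | no _  = cong (0F +F_) (sym -0≡0)

  *ₚ-congʳ : ∀ (p : Poly) {f g : Poly} → (∀ i → f i ≡ g i) → ∀ t → (p *ₚ f) t ≡ (p *ₚ g) t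
  *ₚ-congʳ p eq t = ∑ℕ-cong (suc t) (λ i _ → cong (p i *F_) (eq (t ∸ i)))

  infixr 5 _∷ₚ_

  -- The polynomial c + x h.
  _∷ₚ_ : Carrier → Poly → Poly
  (c ∷ₚ h) zero    = c
  (c ∷ₚ h) (suc i) = h i

  *ₚ-∷ₚ : ∀ (p : Poly) c h t → (p *ₚ (c ∷ₚ h)) (suc t) ≡ (p *ₚ h) t +F p (suc t) *F c
  *ₚ-∷ₚ p c h t = cong₂ _+F_
    (∑ℕ-cong (suc t) (λ { i (s≤s i≤t) → cong (λ l → p i *F (c ∷ₚ h) l) (ℕₚ.+-∸-assoc 1 i≤t) }))
    (cong (λ l → p (suc t) *F (c ∷ₚ h) l) (ℕₚ.n∸n≡0 t))

  coeff : ∀ {m} → Vec m → Poly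
  coeff {m} v t with t ℕ.<? m
  ... | yes t<m = v (fromℕ< t<m)
  ... | no  _   = 0F

  coeff-toℕ : ∀ {m} (v : Vec m) j → coeff v (toℕ j) ≡ v j
  coeff-toℕ {m} v j with toℕ j ℕ.<? m
  ... | yes j<m = cong v (Finₚ.fromℕ<-toℕ j j<m)
  ... | no j≮m  = contradiction (Finₚ.toℕ<n j) j≮m

  coeff-≥ : ∀ {m} (v : Vec m) {t} → m ≤ t → coeff v t ≡ 0F
  coeff-≥ {m} v {t} m≤t with t ℕ.<? m
  ... | yes t<m = contradiction m≤t (ℕₚ.<⇒≱ t<m)
  ... | no _    = refl

  monic-< : ∀ {m} (a : Vec m) j → monic a (toℕ j) ≡ a j
  monic-< {m} a j with toℕ j ℕ.<? m
  ... | yes j<m = cong a (Finₚ.fromℕ<-toℕ j j<m)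
  ... | no j≮m  = contradiction (Finₚ.toℕ<n j) j≮m

  monic-≡ : ∀ {m} (a : Vec m) → monic a m ≡ 1F
  monic-≡ {m} a with m ℕ.<? m
  ... | yes m<m = contradiction m<m (ℕₚ.<-irrefl refl)
  ... | no _ with m ℕ.≟ m
  ...   | yes _  = refl
  ...   | no m≢m = contradiction refl m≢m

  monic-> : ∀ {m} (a : Vec m) {t} → m < t → monic a t ≡ 0F
  monic-> {m} a {t} m<t with t ℕ.<? m
  ... | yes t<m = contradiction t<m (ℕₚ.<-asym m<t)
  ... | no _ with t ℕ.≟ m
  ...   | yes refl = contradiction m<t (ℕₚ.<-irrefl refl)
  ...   | no _     = refl

  -- Uniqueness of the quotient in division by a monic polynomial of degree m.
  monic-*-cancel : ∀ {m} (a : Vec m) {f g : Poly} → FiniteSupport f → FiniteSupport g →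
    (∀ t → m ≤ t → (monic a *ₚ f) t ≡ (monic a *ₚ g) t) → ∀ t → f t ≡ g t
  monic-*-cancel {m} a {f} {g} (d , f≡0) (e , g≡0) agree = descend (suc (d ℕ.⊔ e)) λ t d⊔e<t →
    trans (f≡0 t (ℕₚ.≤-<-trans (ℕₚ.m≤m⊔n d e) d⊔e<t)) (sym (g≡0 t (ℕₚ.≤-<-trans (ℕₚ.m≤n⊔m d e) d⊔e<t)))
    where
    open ≡-Reasoning
    -- In the coefficient of x^(m+d) of the product, the term of index `m` is `f d`. Smaller indices
    -- meet coefficients of `f` above `d`, already matched, and larger ones lie beyond the degree of
    -- the monic factor.
    top : ∀ d → (∀ t → d < t → f t ≡ g t) → f d ≡ g d
    top d above = begin
      f d                          ≡⟨ leading f ⟨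
      monic a m *F f (m + d ∸ m)   ≡⟨ ∑ℕ-cancel (suc (m + d)) (s≤s (ℕₚ.m≤m+n m d)) others (agree (m + d) (ℕₚ.m≤m+n m d)) ⟩
      monic a m *F g (m + d ∸ m)   ≡⟨ leading g ⟩
      g d                          ∎
      where
      leading : ∀ h → monic a m *F h (m + d ∸ m) ≡ h d
      leading h = trans (cong₂ _*F_ (monic-≡ a) (cong h (ℕₚ.m+n∸m≡n m d))) (*-identityˡ (h d))
      others : ∀ i → i < suc (m + d) → ¬ (i ≡ m) → monic a i *F f (m + d ∸ i) ≡ monic a i *F g (m + d ∸ i)
      others i _ i≢m with i ℕ.<? m
      ... | yes i<m = cong (_ *F_) (above _ (subst (d <_) (sym (ℕₚ.+-∸-comm d (ℕₚ.<⇒≤ i<m))) (ℕₚ.m<n+m d (ℕₚ.m<n⇒0<n∸m i<m))))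
      ... | no i≮m with i ℕ.≟ m
      ...   | yes i≡m = contradiction i≡m i≢m
      ...   | no _    = trans (zeroˡ _) (sym (zeroˡ _))
    descend : ∀ d → (∀ t → d ≤ t → f t ≡ g t) → ∀ t → f t ≡ g t
    descend zero    above t = above t z≤n
    descend (suc d) above   = descend d λ t d≤t → [ above t , (λ { refl → top d above }) ] (ℕₚ.m≤n⇒m<n∨m≡n d≤t)

  ∑-last : ∀ {n} (f : Fin (suc n) → Carrier) → ∑ f ≡ ∑ (f ∘ Fin.inject₁) +F f (Fin.fromℕ n)
  ∑-last {zero}  f = +-comm (f zero) 0F
  ∑-last {suc n} f = trans (cong (f zero +F_) (∑-last (f ∘ suc))) (sym (+-assoc _ _ _))

  companion-last : ∀ {m} (a : Vec (suc m)) j → companion a (Fin.fromℕ m) j ≡ -F a j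
  companion-last {m} a j with suc (toℕ (Fin.fromℕ m)) ℕ.≟ suc m
  ... | yes _  = refl
  ... | no neq = contradiction (cong suc (Finₚ.toℕ-fromℕ m)) neq

  companion-inject₁ : ∀ {m} (a : Vec (suc m)) (i : Fin m) → companion a (Fin.inject₁ i) ≋ δ (suc i)
  companion-inject₁ {m} a i j with suc (toℕ (Fin.inject₁ i)) ℕ.≟ suc m
  ... | yes eq = contradiction (trans (sym (Finₚ.toℕ-inject₁ i)) (ℕₚ.suc-injective eq)) (ℕₚ.<⇒≢ (Finₚ.toℕ<n i))
  ... | no _ with suc (toℕ (Fin.inject₁ i)) ℕ.≟ toℕ j
  ...   | yes eq = sym (δ-≡ (suc i) j (trans (cong suc (sym (Finₚ.toℕ-inject₁ i))) eq))
  ...   | no neq = sym (δ-≢ (suc i) j (neq ∘ trans (cong suc (Finₚ.toℕ-inject₁ i))))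

  -- Multiplication by x with the overflowing top coefficient dropped.
  shift : ∀ {m} → Vec (suc m) → Vec (suc m)
  shift v zero    = 0F
  shift v (suc j) = v (Fin.inject₁ j)

  -- Multiplication by x modulo the monic polynomial: the overflow is replaced by means of x^(m+1) =
  -- -Σ a_j x^j.
  ·ᵥ-companion : ∀ {m} (a v : Vec (suc m)) j →
    (v ·ᵥ companion a) j ≡ shift v j +F -F (a j *F v (Fin.fromℕ m))
  ·ᵥ-companion {m} a v j = trans (∑-last (λ i → v i *F companion a i j)) (cong₂ _+F_
    (trans (∑-cong (λ i → cong (v (Fin.inject₁ i) *F_) (companion-inject₁ a i j))) (go j))
    (trans (cong (v (Fin.fromℕ m) *F_) (companion-last a j)) (trans (sym (-‿distribʳ-* _ _)) (cong -F_ (*-comm _ _)))))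
    where
    go : ∀ j → ∑ (λ i → v (Fin.inject₁ i) *F δ (suc i) j) ≡ shift v j
    go zero    = trans (∑-cong (λ i → zeroʳ (v (Fin.inject₁ i)))) (∑-zero m)
    go (suc j) = trans (∑-cong (λ i → cong (v (Fin.inject₁ i) *F_) (δ-suc i j))) (·ᵥ-identity (v ∘ Fin.inject₁) j)

  ·ᵥ-^ₘ-+ : ∀ {n} (A : Mat n n) i j v → v ·ᵥ A ^ₘ (i + j) ≋ (v ·ᵥ A ^ₘ i) ·ᵥ A ^ₘ j
  ·ᵥ-^ₘ-+ A zero    j v l = ·ᵥ-congˡ (A ^ₘ j) (sym ∘ ·ᵥ-identity v) l
  ·ᵥ-^ₘ-+ A (suc i) j v l = begin
    (v ·ᵥ (A ·ₘ A ^ₘ (i + j))) l            ≡⟨ ·ᵥ-assoc v A (A ^ₘ (i + j)) l ⟨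
    (v ·ᵥ A ·ᵥ A ^ₘ (i + j)) l              ≡⟨ ·ᵥ-^ₘ-+ A i j (v ·ᵥ A) l ⟩
    (v ·ᵥ A ·ᵥ A ^ₘ i ·ᵥ A ^ₘ j) l          ≡⟨ ·ᵥ-congˡ (A ^ₘ j) (·ᵥ-assoc v A (A ^ₘ i)) l ⟩
    (v ·ᵥ (A ·ₘ A ^ₘ i) ·ᵥ A ^ₘ j) l        ∎
    where open ≡-Reasoning

  ·ᵥ-^ₘ-comm : ∀ {n} (A : Mat n n) i j v → (v ·ᵥ A ^ₘ i) ·ᵥ A ^ₘ j ≋ (v ·ᵥ A ^ₘ j) ·ᵥ A ^ₘ i
  ·ᵥ-^ₘ-comm A i j v l = begin
    (v ·ᵥ A ^ₘ i ·ᵥ A ^ₘ j) l  ≡⟨ ·ᵥ-^ₘ-+ A i j v l ⟨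
    (v ·ᵥ A ^ₘ (i + j)) l      ≡⟨ cong (λ e → (v ·ᵥ A ^ₘ e) l) (ℕₚ.+-comm i j) ⟩
    (v ·ᵥ A ^ₘ (j + i)) l      ≡⟨ ·ᵥ-^ₘ-+ A j i v l ⟩
    (v ·ᵥ A ^ₘ j ·ᵥ A ^ₘ i) l  ∎
    where open ≡-Reasoning

  ^ₘ-suc : ∀ {n} (A : Mat n n) e v → v ·ᵥ A ^ₘ suc e ≋ (v ·ᵥ A ^ₘ e) ·ᵥ A
  ^ₘ-suc A e v l = begin
    (v ·ᵥ A ^ₘ suc e) l               ≡⟨ cong (λ e → (v ·ᵥ A ^ₘ e) l) (ℕₚ.+-comm 1 e) ⟩
    (v ·ᵥ A ^ₘ (e + 1)) l             ≡⟨ ·ᵥ-^ₘ-+ A e 1 v l ⟩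
    (v ·ᵥ A ^ₘ e ·ᵥ (A ·ₘ I)) l       ≡⟨ ·ᵥ-congʳ (v ·ᵥ A ^ₘ e) (λ i → ·ᵥ-identity (A i)) l ⟩
    (v ·ᵥ A ^ₘ e ·ᵥ A) l              ∎
    where open ≡-Reasoning

-- Powers of the companion matrix of a primitive polynomial.

-- The row vector δ zero · M^e holds the coefficients of x^e modulo the
-- primitive polynomial p, so the order of M is that of x modulo p, and counting
-- shows that the powers of x exhaust the nonzero residues.
module PrimitiveCompanion (F : FiniteField) (k : ℕ) (a : Ops.Vec F (suc k)) (prim : Ops.IsPrimitive F a) where
  open Polynomial F public

  M : Mat (suc k) (suc k)
  M = companion a

  N : ℕ
  N = q ^ suc k ∸ 1

  residue : ℕ → Vec (suc k)
  residue e = δ zero ·ᵥ M ^ₘ e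

  -- The quotient of x^e by p, built in Horner's manner: multiplying x^e by x multiplies the old
  -- quotient by x and adds the top coefficient of the remainder, which is the multiple of p taken
  -- away in the reduction.
  quotient : ℕ → Poly
  quotient zero    = λ _ → 0F
  quotient (suc e) = residue e (Fin.fromℕ k) ∷ₚ quotient e

  quotient-support : ∀ e t → e ≤ t → quotient e t ≡ 0F
  quotient-support zero    t       _         = refl
  quotient-support (suc e) (suc t) (s≤s e≤t) = quotient-support e t e≤t

  quotient-finite : ∀ e → FiniteSupport (quotient e)
  quotient-finite e = e , λ t e<t → quotient-support e t (ℕₚ.<⇒≤ e<t)

  residue-0 : residue 0 ≋ δ zero
  residue-0 = ·ᵥ-identity (δ zero)

  residue-suc : ∀ e j → residue (suc e) j ≡ shift (residue e) j +F -F (a j *F residue e (Fin.fromℕ k))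
  residue-suc e j = trans (^ₘ-suc M e (δ zero) j) (·ᵥ-companion a (residue e) j)

  coeff-residue-0 : ∀ t → coeff (residue 0) t ≡ χ t 0
  coeff-residue-0 zero    = residue-0 zero
  coeff-residue-0 (suc t) with suc t ℕ.<? suc k
  ... | yes t<k = residue-0 (fromℕ< t<k)
  ... | no _    = refl

  coeff-fromℕ< : ∀ {m} (v : Vec m) {t} (t<m : t < m) → coeff v t ≡ v (fromℕ< t<m)
  coeff-fromℕ< v {t} t<m = trans (cong (coeff v) (sym (Finₚ.toℕ-fromℕ< t<m))) (coeff-toℕ v _)

  x+y-y : ∀ x y → x +F y +F -F y ≡ x
  x+y-y x y = trans (+-assoc x y (-F y)) (trans (cong (x +F_) (-‿inverseʳ y)) (+-identityʳ x))

  x-y+y : ∀ x y → x +F -F y +F y ≡ x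
  x-y+y x y = trans (+-assoc x (-F y) y) (trans (cong (x +F_) (-‿inverseˡ y)) (+-identityʳ x))

  -- One reduction step c p + r′ = x r, read at x^t, where r and r′ are consecutive remainders and c
  -- is the top coefficient of r. The `χ` term restores the coefficient that `shift` drops.
  coeff-residue-suc : ∀ e t → monic a t *F residue e (Fin.fromℕ k) +F coeff (residue (suc e)) t ≡ coeff (shift (residue e)) t +F χ t (suc k) *F residue e (Fin.fromℕ k)
  coeff-residue-suc e t with ℕₚ.<-cmp t (suc k)
  ... | tri< t<m t≢m _ = begin
    monic a t *F c +F coeff (residue (suc e)) t
      ≡⟨ cong₂ (λ x y → x *F c +F y) (trans (cong (monic a) (sym (Finₚ.toℕ-fromℕ< t<m))) (monic-< a _)) (trans (coeff-fromℕ< _ t<m) (residue-suc e _)) ⟩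
    a (fromℕ< t<m) *F c +F (shift (residue e) (fromℕ< t<m) +F -F (a (fromℕ< t<m) *F c))
      ≡⟨ +-comm _ _ ⟩
    shift (residue e) (fromℕ< t<m) +F -F (a (fromℕ< t<m) *F c) +F a (fromℕ< t<m) *F c
      ≡⟨ x-y+y _ _ ⟩
    shift (residue e) (fromℕ< t<m)
      ≡⟨ coeff-fromℕ< _ t<m ⟨
    coeff (shift (residue e)) t
      ≡⟨ +-identityʳ _ ⟨
    coeff (shift (residue e)) t +F 0F
      ≡⟨ cong (coeff (shift (residue e)) t +F_) (trans (cong (_*F c) (χ-≢ t≢m)) (zeroˡ c)) ⟨
    coeff (shift (residue e)) t +F χ t (suc k) *F c ∎
    where
    open ≡-Reasoning
    c = residue e (Fin.fromℕ k)
  ... | tri≈ _ refl _ = begin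
    monic a (suc k) *F c +F coeff (residue (suc e)) (suc k)
      ≡⟨ cong₂ (λ x y → x *F c +F y) (trans (monic-≡ a) (sym (χ-≡ (suc k)))) (trans (coeff-≥ (residue (suc e)) ℕₚ.≤-refl) (sym (coeff-≥ (shift (residue e)) ℕₚ.≤-refl))) ⟩
    χ (suc k) (suc k) *F c +F coeff (shift (residue e)) (suc k)
      ≡⟨ +-comm _ _ ⟩
    coeff (shift (residue e)) (suc k) +F χ (suc k) (suc k) *F c ∎
    where
    open ≡-Reasoning
    c = residue e (Fin.fromℕ k)
  ... | tri> _ t≢m m<t = begin
    monic a t *F c +F coeff (residue (suc e)) t
      ≡⟨ cong₂ (λ x y → x *F c +F y) (trans (monic-> a m<t) (sym (χ-≢ t≢m))) (trans (coeff-≥ (residue (suc e)) (ℕₚ.<⇒≤ m<t)) (sym (coeff-≥ (shift (residue e)) (ℕₚ.<⇒≤ m<t)))) ⟩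
    χ t (suc k) *F c +F coeff (shift (residue e)) t
      ≡⟨ +-comm _ _ ⟩
    coeff (shift (residue e)) t +F χ t (suc k) *F c ∎
    where
    open ≡-Reasoning
    c = residue e (Fin.fromℕ k)

  coeff-shift : ∀ (v : Vec (suc k)) t → coeff (shift v) (suc t) +F χ (suc t) (suc k) *F v (Fin.fromℕ k) ≡ coeff v t
  coeff-shift v t with ℕₚ.<-cmp t k
  ... | tri< t<k t≢k _ = begin
    coeff (shift v) (suc t) +F χ (suc t) (suc k) *F v (Fin.fromℕ k)
      ≡⟨ cong₂ _+F_ (coeff-fromℕ< (shift v) (s≤s t<k)) (trans (cong (_*F v (Fin.fromℕ k)) (χ-≢ (t≢k ∘ ℕₚ.suc-injective))) (zeroˡ _)) ⟩
    v (Fin.inject₁ (fromℕ< t<k)) +F 0F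
      ≡⟨ +-identityʳ _ ⟩
    v (Fin.inject₁ (fromℕ< t<k))
      ≡⟨ coeff-toℕ v _ ⟨
    coeff v (toℕ (Fin.inject₁ (fromℕ< t<k)))
      ≡⟨ cong (coeff v) (trans (Finₚ.toℕ-inject₁ _) (Finₚ.toℕ-fromℕ< t<k)) ⟩
    coeff v t ∎
    where open ≡-Reasoning
  ... | tri≈ _ refl _ = begin
    coeff (shift v) (suc k) +F χ (suc k) (suc k) *F v (Fin.fromℕ k)
      ≡⟨ cong₂ _+F_ (coeff-≥ (shift v) ℕₚ.≤-refl) (trans (cong (_*F v (Fin.fromℕ k)) (χ-≡ (suc k))) (*-identityˡ _)) ⟩
    0F +F v (Fin.fromℕ k)
      ≡⟨ +-identityˡ _ ⟩
    v (Fin.fromℕ k)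
      ≡⟨ coeff-toℕ v _ ⟨
    coeff v (toℕ (Fin.fromℕ k))
      ≡⟨ cong (coeff v) (Finₚ.toℕ-fromℕ k) ⟩
    coeff v k ∎
    where open ≡-Reasoning
  ... | tri> _ t≢k k<t = begin
    coeff (shift v) (suc t) +F χ (suc t) (suc k) *F v (Fin.fromℕ k)
      ≡⟨ cong₂ _+F_ (coeff-≥ (shift v) (s≤s (ℕₚ.<⇒≤ k<t))) (trans (cong (_*F v (Fin.fromℕ k)) (χ-≢ (t≢k ∘ ℕₚ.suc-injective))) (zeroˡ _)) ⟩
    0F +F 0F
      ≡⟨ +-identityˡ 0F ⟩
    0F
      ≡⟨ coeff-≥ v k<t ⟨
    coeff v t ∎
    where open ≡-Reasoning

  -- Euclidean division of x^e by p. The inductive step multiplies the identity by x and reduces the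
  -- remainder once.
  division : ∀ e t → (monic a *ₚ quotient e) t +F coeff (residue e) t ≡ χ t e
  division zero    t = trans
    (cong₂ _+F_ (∑ℕ-zero (suc t) (λ i _ → zeroʳ (monic a i))) (coeff-residue-0 t))
    (+-identityˡ _)
  division (suc e) zero = begin
    0F +F monic a 0 *F c +F coeff (residue (suc e)) 0   ≡⟨ cong (_+F coeff (residue (suc e)) 0) (+-identityˡ _) ⟩
    monic a 0 *F c +F coeff (residue (suc e)) 0         ≡⟨ coeff-residue-suc e 0 ⟩
    0F +F 0F *F c                                       ≡⟨ trans (+-identityˡ _) (zeroˡ c) ⟩
    0F                                                  ∎
    where
    open ≡-Reasoning
    c = residue e (Fin.fromℕ k)
  division (suc e) (suc t) = begin
    (monic a *ₚ quotient (suc e)) (suc t) +F coeff (residue (suc e)) (suc t)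
      ≡⟨ cong (_+F coeff (residue (suc e)) (suc t)) (*ₚ-∷ₚ (monic a) c (quotient e) t) ⟩
    (monic a *ₚ quotient e) t +F monic a (suc t) *F c +F coeff (residue (suc e)) (suc t)
      ≡⟨ +-assoc _ _ _ ⟩
    (monic a *ₚ quotient e) t +F (monic a (suc t) *F c +F coeff (residue (suc e)) (suc t))
      ≡⟨ cong ((monic a *ₚ quotient e) t +F_) (trans (coeff-residue-suc e (suc t)) (coeff-shift (residue e) t)) ⟩
    (monic a *ₚ quotient e) t +F coeff (residue e) t
      ≡⟨ division e t ⟩
    χ t e
      ≡⟨ χ-suc t e ⟨
    χ (suc t) (suc e) ∎
    where
    open ≡-Reasoning
    c = residue e (Fin.fromℕ k)

  residue≋δ⇒∣ : ∀ e → residue e ≋ δ zero → monic a ∣ₚ xe-1 e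
  residue≋δ⇒∣ e eq = quotient e , quotient-finite e , λ t → begin
    (monic a *ₚ quotient e) t
      ≡⟨ x+y-y _ (coeff (residue e) t) ⟨
    (monic a *ₚ quotient e) t +F coeff (residue e) t +F -F coeff (residue e) t
      ≡⟨ cong₂ (λ x y → x +F -F y) (division e t) (trans (coeff-cong t) (coeff-residue-0 t)) ⟩
    χ t e +F -F χ t 0
      ≡⟨ xe-1≡χ e t ⟨
    xe-1 e t ∎
    where
    open ≡-Reasoning
    coeff-cong : ∀ t → coeff (residue e) t ≡ coeff (residue 0) t
    coeff-cong t with t ℕ.<? suc k
    ... | yes t<m = trans (eq (fromℕ< t<m)) (sym (residue-0 (fromℕ< t<m)))
    ... | no _    = refl

  -- The cofactor `h` is arbitrary, but a quotient by a monic polynomial is determined by the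
  -- product in degrees at least `suc k`, where neither the remainder nor the constant 1
  -- contributes. So `h` is `quotient e`, and comparing low coefficients gives remainder 1.
  ∣⇒residue≋δ : ∀ e → monic a ∣ₚ xe-1 e → residue e ≋ δ zero
  ∣⇒residue≋δ e (h , h-finite , ph≡xe-1) j = begin
    residue e j                 ≡⟨ coeff-toℕ (residue e) j ⟨
    coeff (residue e) (toℕ j)   ≡⟨ +-cancelˡ ((monic a *ₚ quotient e) (toℕ j)) _ _ (begin
        (monic a *ₚ quotient e) (toℕ j) +F coeff (residue e) (toℕ j)  ≡⟨ division e (toℕ j) ⟩
        χ (toℕ j) e                                                   ≡⟨ ph+χ (toℕ j) ⟨
        (monic a *ₚ h) (toℕ j) +F χ (toℕ j) 0                         ≡⟨ cong (_+F χ (toℕ j) 0) (*ₚ-congʳ (monic a) h≡quotient (toℕ j)) ⟩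
        (monic a *ₚ quotient e) (toℕ j) +F χ (toℕ j) 0                ∎) ⟩
    χ (toℕ j) 0                 ≡⟨ coeff-residue-0 (toℕ j) ⟨
    coeff (residue 0) (toℕ j)   ≡⟨ coeff-toℕ (residue 0) j ⟩
    residue 0 j                 ≡⟨ residue-0 j ⟩
    δ zero j                    ∎
    where
    open ≡-Reasoning
    ph+χ : ∀ t → (monic a *ₚ h) t +F χ t 0 ≡ χ t e
    ph+χ t = trans (cong (_+F χ t 0) (trans (ph≡xe-1 t) (xe-1≡χ e t))) (x-y+y _ _)
    h≡quotient : ∀ t → h t ≡ quotient e t
    h≡quotient = monic-*-cancel a h-finite (quotient-finite e) agree
      where
      agree : ∀ t → suc k ≤ t → (monic a *ₚ h) t ≡ (monic a *ₚ quotient e) t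
      -- Exposing the successor lets `χ t 0` compute to `0F`.
      agree t@(suc _) m≤t = begin
        (monic a *ₚ h) t                                   ≡⟨ +-identityʳ _ ⟨
        (monic a *ₚ h) t +F χ t 0                          ≡⟨ ph+χ t ⟩
        χ t e                                              ≡⟨ division e t ⟨
        (monic a *ₚ quotient e) t +F coeff (residue e) t   ≡⟨ cong ((monic a *ₚ quotient e) t +F_) (coeff-≥ (residue e) m≤t) ⟩
        (monic a *ₚ quotient e) t +F 0F                    ≡⟨ +-identityʳ _ ⟩
        (monic a *ₚ quotient e) t                          ∎

  q^m≡1+N : q ^ suc k ≡ suc N
  q^m≡1+N = sym (ℕₚ.m+[n∸m]≡n (ℕₚ.m^n>0 q {{ℕ.>-nonZero (ℕₚ.<⇒≤ 1<q)}} (suc k)))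

  0<N : 0 < N
  0<N = proj₁ (proj₁ (proj₂ prim))

  residue-N : residue N ≋ δ zero
  residue-N = ∣⇒residue≋δ N (proj₂ (proj₁ (proj₂ prim)))

  order-least : ∀ e → 0 < e → residue e ≋ δ zero → N ≤ e
  order-least e 0<e eq = proj₂ (proj₂ prim) e (0<e , residue≋δ⇒∣ e eq)

  -- For `l ≤ k`, x^l is its own remainder. Thus `δ zero` is a cyclic vector of `M`.
  residue-basis : ∀ l → residue (toℕ l) ≋ δ l
  residue-basis l = go (toℕ l) l refl
    where
    go : ∀ t l → toℕ l ≡ t → residue t ≋ δ l
    go zero    zero    refl = residue-0
    go (suc t) (suc l) eq j = begin
      residue (suc t) j              ≡⟨ ^ₘ-suc M t (δ zero) j ⟩
      (residue t ·ᵥ M) j             ≡⟨ ·ᵥ-congˡ M (go t (Fin.inject₁ l) (trans (Finₚ.toℕ-inject₁ l) (ℕₚ.suc-injective eq))) j ⟩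
      (δ (Fin.inject₁ l) ·ᵥ M) j     ≡⟨ δ-·ᵥ (Fin.inject₁ l) M j ⟩
      M (Fin.inject₁ l) j            ≡⟨ companion-inject₁ a l j ⟩
      δ (suc l) j                    ∎
      where open ≡-Reasoning

  residue-+ : ∀ i j → residue (i + j) ≋ residue i ·ᵥ M ^ₘ j
  residue-+ i j = ·ᵥ-^ₘ-+ M i j (δ zero)

  -- `M ^ₘ N` fixes `δ zero` and commutes with the powers of `M`, so it fixes every translate of
  -- `δ zero`, and these include the standard basis.
  M^N≈I : (M ^ₘ N) ≈ₘ I
  M^N≈I l j = begin
    (M ^ₘ N) l j                         ≡⟨ δ-·ᵥ l (M ^ₘ N) j ⟨
    (δ l ·ᵥ M ^ₘ N) j                    ≡⟨ ·ᵥ-congˡ (M ^ₘ N) (residue-basis l) j ⟨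
    (residue (toℕ l) ·ᵥ M ^ₘ N) j        ≡⟨ ·ᵥ-^ₘ-comm M (toℕ l) N (δ zero) j ⟩
    (residue N ·ᵥ M ^ₘ toℕ l) j          ≡⟨ ·ᵥ-congˡ (M ^ₘ toℕ l) residue-N j ⟩
    residue (toℕ l) j                    ≡⟨ residue-basis l j ⟩
    δ l j                                ∎
    where open ≡-Reasoning

  period : ∀ v → v ·ᵥ M ^ₘ N ≋ v
  period v j = trans (·ᵥ-congʳ v M^N≈I j) (·ᵥ-identity v j)

  period-* : ∀ i v → v ·ᵥ M ^ₘ (i * N) ≋ v
  period-* zero    v j = ·ᵥ-identity v j
  period-* (suc i) v j = begin
    (v ·ᵥ M ^ₘ (N + i * N)) j           ≡⟨ ·ᵥ-^ₘ-+ M N (i * N) v j ⟩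
    ((v ·ᵥ M ^ₘ N) ·ᵥ M ^ₘ (i * N)) j   ≡⟨ period-* i (v ·ᵥ M ^ₘ N) j ⟩
    (v ·ᵥ M ^ₘ N) j                     ≡⟨ period v j ⟩
    v j                                 ∎
    where open ≡-Reasoning

  -- A natural exponent that acts as `−i`: `i + cofactor i` is a multiple of the period `N`.
  cofactor : ℕ → ℕ
  cofactor i = i * N ∸ i

  i+cofactor : ∀ i → i + cofactor i ≡ i * N
  i+cofactor i = ℕₚ.m+[n∸m]≡n (ℕₚ.m≤m*n i N {{ℕ.>-nonZero 0<N}})

  M^-inverse : ∀ i v → (v ·ᵥ M ^ₘ i) ·ᵥ M ^ₘ cofactor i ≋ v
  M^-inverse i v j = begin
    ((v ·ᵥ M ^ₘ i) ·ᵥ M ^ₘ cofactor i) j   ≡⟨ ·ᵥ-^ₘ-+ M i (cofactor i) v j ⟨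
    (v ·ᵥ M ^ₘ (i + cofactor i)) j         ≡⟨ cong (λ e → (v ·ᵥ M ^ₘ e) j) (i+cofactor i) ⟩
    (v ·ᵥ M ^ₘ (i * N)) j                  ≡⟨ period-* i v j ⟩
    v j                                    ∎
    where open ≡-Reasoning

  M^-injective : ∀ i {v w} → v ·ᵥ M ^ₘ i ≋ w ·ᵥ M ^ₘ i → v ≋ w
  M^-injective i {v} {w} eq j =
    trans (sym (M^-inverse i v j)) (trans (·ᵥ-congˡ (M ^ₘ cofactor i) eq j) (M^-inverse i w j))

  M^-indep : ∀ i → LinIndepRows (M ^ₘ i)
  M^-indep i c eq = M^-injective i (λ j → trans (eq j) (sym (·ᵥ-zeroˡ (M ^ₘ i) j)))

  residue≢0 : ∀ i → ¬ (residue i ≋ 0ᵥ)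
  residue≢0 i eq = 0≢1 (trans (sym (M^-indep i (δ zero) eq zero)) (δ-≡ {suc k} zero zero refl))

  -- A coincidence would make `j ∸ i`, which is positive and below `N`, a period of `δ zero`.
  residue-distinct-< : ∀ {i j} → i < j → j < N → ¬ (residue i ≋ residue j)
  residue-distinct-< {i} {j} i<j j<N eq = ℕₚ.<⇒≱ j<N (ℕₚ.≤-trans
    (order-least (j ∸ i) (ℕₚ.m<n⇒0<n∸m i<j) (M^-injective i λ l → begin
      (residue (j ∸ i) ·ᵥ M ^ₘ i) l   ≡⟨ residue-+ (j ∸ i) i l ⟨
      residue (j ∸ i + i) l           ≡⟨ cong (λ e → residue e l) (ℕₚ.m∸n+n≡m (ℕₚ.<⇒≤ i<j)) ⟩
      residue j l                     ≡⟨ eq l ⟨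
      residue i l                     ∎))
    (ℕₚ.m∸n≤m j i))
    where open ≡-Reasoning

  residue-distinct : ∀ {i j} → i < N → j < N → residue i ≋ residue j → i ≡ j
  residue-distinct {i} {j} i<N j<N eq with ℕₚ.<-cmp i j
  ... | tri< i<j _ _ = contradiction eq (residue-distinct-< i<j j<N)
  ... | tri≈ _ i≡j _ = i≡j
  ... | tri> _ _ j<i = contradiction (sym ∘ eq) (residue-distinct-< j<i i<N)

  -- 0, v and the N distinct powers would be N + 2 distinct vectors if v were not among the powers.
  residue-surjective : ∀ {v} → ¬ (v ≋ 0ᵥ) → Σ[ i ∈ ℕ ] (residue i ≋ v)
  residue-surjective {v} v≢0 with Finₚ.any? {n = N} (λ i → residue (toℕ i) ≟ᵥ v)
  ... | yes (i , eq) = toℕ i , eq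
  ... | no none = contradiction
    (Finₚ.injective⇒≤ {f = codeᵥ ∘ vectors} (λ {i} {j} → vectors-injective i j ∘ codeᵥ-injective))
    (subst (λ n → ¬ (suc (suc N) ≤ n)) (sym q^m≡1+N) ℕₚ.1+n≰n)
    where
    vectors : Fin (suc (suc N)) → Vec (suc k)
    vectors zero          = 0ᵥ
    vectors (suc zero)    = v
    vectors (suc (suc i)) = residue (toℕ i)
    vectors-injective : ∀ i j → vectors i ≋ vectors j → i ≡ j
    vectors-injective zero zero _ = refl
    vectors-injective zero (suc zero) eq = contradiction (sym ∘ eq) v≢0
    vectors-injective zero (suc (suc j)) eq = contradiction (sym ∘ eq) (residue≢0 (toℕ j))
    vectors-injective (suc zero) zero eq = contradiction eq v≢0
    vectors-injective (suc zero) (suc zero) _ = refl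
    vectors-injective (suc zero) (suc (suc j)) eq = contradiction (j , sym ∘ eq) none
    vectors-injective (suc (suc i)) zero eq = contradiction eq (residue≢0 (toℕ i))
    vectors-injective (suc (suc i)) (suc zero) eq = contradiction (i , eq) none
    vectors-injective (suc (suc i)) (suc (suc j)) eq =
      cong (Fin.suc ∘ suc) (Finₚ.toℕ-injective (residue-distinct (Finₚ.toℕ<n i) (Finₚ.toℕ<n j) eq))

  transitive : ∀ {v w} → ¬ (v ≋ 0ᵥ) → ¬ (w ≋ 0ᵥ) → Σ[ j ∈ ℕ ] (v ·ᵥ M ^ₘ j ≋ w)
  transitive {v} {w} v≢0 w≢0 with residue-surjective v≢0 | residue-surjective w≢0
  -- `cofactor i` steps lead from `v` back to `δ zero`, and `l` more lead on to `w`.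
  ... | i , eqᵥ | l , eq_w = cofactor i + l , λ j → begin
    (v ·ᵥ M ^ₘ (cofactor i + l)) j                      ≡⟨ ·ᵥ-^ₘ-+ M (cofactor i) l v j ⟩
    ((v ·ᵥ M ^ₘ cofactor i) ·ᵥ M ^ₘ l) j                ≡⟨ ·ᵥ-congˡ (M ^ₘ l) (·ᵥ-congˡ (M ^ₘ cofactor i) eqᵥ) j ⟨
    ((residue i ·ᵥ M ^ₘ cofactor i) ·ᵥ M ^ₘ l) j        ≡⟨ ·ᵥ-congˡ (M ^ₘ l) (M^-inverse i (δ zero)) j ⟩
    residue l j                                         ≡⟨ eq_w j ⟩
    w j                                                 ∎
    where open ≡-Reasoning

  -- By transitivity every vector is a translate of v by a power of M, which commutes with M^i and M^j.
  rigid : ∀ i j s {v} → ¬ (v ≋ 0ᵥ) → v ·ᵥ M ^ₘ i ≋ s ⊙ (v ·ᵥ M ^ₘ j) → ∀ w → w ·ᵥ M ^ₘ i ≋ s ⊙ (w ·ᵥ M ^ₘ j)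
  rigid i j s {v} v≢0 eq w with w ≟ᵥ 0ᵥ
  ... | yes w≋0 = λ l → trans (vanish i l) (sym (trans (cong (s *F_) (vanish j l)) (zeroʳ s)))
    where
    vanish : ∀ e → w ·ᵥ M ^ₘ e ≋ 0ᵥ
    vanish e l = trans (·ᵥ-congˡ (M ^ₘ e) w≋0 l) (·ᵥ-zeroˡ (M ^ₘ e) l)
  ... | no w≢0 = λ l → begin
    (w ·ᵥ M ^ₘ i) l                      ≡⟨ ·ᵥ-congˡ (M ^ₘ i) vM^t≋w l ⟨
    ((v ·ᵥ M ^ₘ t) ·ᵥ M ^ₘ i) l          ≡⟨ ·ᵥ-^ₘ-comm M t i v l ⟩
    ((v ·ᵥ M ^ₘ i) ·ᵥ M ^ₘ t) l          ≡⟨ ·ᵥ-congˡ (M ^ₘ t) eq l ⟩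
    ((s ⊙ (v ·ᵥ M ^ₘ j)) ·ᵥ M ^ₘ t) l    ≡⟨ ·ᵥ-⊙ s (v ·ᵥ M ^ₘ j) (M ^ₘ t) l ⟩
    s *F ((v ·ᵥ M ^ₘ j) ·ᵥ M ^ₘ t) l     ≡⟨ cong (s *F_) (·ᵥ-^ₘ-comm M j t v l) ⟩
    s *F ((v ·ᵥ M ^ₘ t) ·ᵥ M ^ₘ j) l     ≡⟨ cong (s *F_) (·ᵥ-congˡ (M ^ₘ j) vM^t≋w l) ⟩
    s *F (w ·ᵥ M ^ₘ j) l                 ∎
    where
    open ≡-Reasoning
    t = proj₁ (transitive v≢0 w≢0)
    vM^t≋w : v ·ᵥ M ^ₘ t ≋ w
    vM^t≋w = proj₂ (transitive v≢0 w≢0)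

  rigid₁ : ∀ i j {v} → ¬ (v ≋ 0ᵥ) → v ·ᵥ M ^ₘ i ≋ v ·ᵥ M ^ₘ j → ∀ w → w ·ᵥ M ^ₘ i ≋ w ·ᵥ M ^ₘ j
  rigid₁ i j {v} v≢0 eq w l =
    trans (rigid i j 1F v≢0 (λ l → trans (eq l) (sym (*-identityˡ _))) w l) (*-identityˡ _)

  -- By `rigid₁`, a nonzero vector killed by `M^j − M^i` would make the two powers equal; so this
  -- square matrix has independent rows, which span.
  difference-surjective : ∀ i j → ¬ (residue i ≋ residue j) → ∀ t →
    Σ[ e ∈ Vec (suc k) ] (e ·ᵥ M ^ₘ j ≋ t ⊕ e ·ᵥ M ^ₘ i)
  difference-surjective i j i≢j t = e , λ l → begin
    (e ·ᵥ M ^ₘ j) l                                             ≡⟨ x-y+y _ _ ⟨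
    (e ·ᵥ M ^ₘ j) l +F -F (e ·ᵥ M ^ₘ i) l +F (e ·ᵥ M ^ₘ i) l    ≡⟨ cong (_+F (e ·ᵥ M ^ₘ i) l) (trans (sym (·ᵥ-D e l)) (sym (proj₂ t∈D l))) ⟩
    t l +F (e ·ᵥ M ^ₘ i) l                                      ∎
    where
    open ≡-Reasoning
    D : Mat (suc k) (suc k)
    D l = (M ^ₘ j) l ⊕ ⊖ (M ^ₘ i) l
    ·ᵥ-D : ∀ c → c ·ᵥ D ≋ c ·ᵥ M ^ₘ j ⊕ ⊖ (c ·ᵥ M ^ₘ i)
    ·ᵥ-D c l = begin
      (c ·ᵥ D) l
        ≡⟨ ∑-cong (λ h → trans (distribˡ (c h) ((M ^ₘ j) h l) (-F (M ^ₘ i) h l)) (cong (c h *F (M ^ₘ j) h l +F_) (trans (sym (-‿distribʳ-* _ _)) (-‿distribˡ-* _ _)))) ⟩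
      ∑ (λ h → c h *F (M ^ₘ j) h l +F (⊖ c) h *F (M ^ₘ i) h l)
        ≡⟨ ∑-distrib-+ (λ h → c h *F (M ^ₘ j) h l) (λ h → (⊖ c) h *F (M ^ₘ i) h l) ⟩
      (c ·ᵥ M ^ₘ j) l +F ((⊖ c) ·ᵥ M ^ₘ i) l
        ≡⟨ cong ((c ·ᵥ M ^ₘ j) l +F_) (·ᵥ-⊖ c (M ^ₘ i) l) ⟩
      (c ·ᵥ M ^ₘ j) l +F -F (c ·ᵥ M ^ₘ i) l ∎
    D-indep : LinIndepRows D
    D-indep c cD≋0 with c ≟ᵥ 0ᵥ
    ... | yes c≋0 = c≋0
    ... | no c≢0 = contradiction
      (λ l → sym (rigid₁ j i c≢0 (λ l → x-y≡0⇒x≡y ((c ·ᵥ M ^ₘ j) l) ((c ·ᵥ M ^ₘ i) l) (trans (sym (·ᵥ-D c l)) (cD≋0 l))) (δ zero) l)) i≢j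
    t∈D : InRowsp D t
    t∈D = dim-n⇒full (indep⇒dim {A = D} D-indep) t
    e = proj₁ t∈D

-- The distance bound as a sum over dimensions.

-- The summand of odBound is local to a where block; unification recovers it.
capture-term : ∀ n → Σ[ f ∈ (ℕ → ℕ) ] (odBound n ≡ 2 * sumTo (n ∸ 1) f)
capture-term n = _ , refl

term : ℕ → ℕ → ℕ
term n = proj₁ (capture-term n)

term-≤ : ∀ n t → 2 * t ≤ n → term n t ≡ t
term-≤ n t 2t≤n with 2 * t ℕ.≤? n
... | yes _    = refl
... | no 2t≰n = contradiction 2t≤n 2t≰n

term-> : ∀ n t → ¬ (2 * t ≤ n) → term n t ≡ n ∸ t
term-> n t 2t≰n with 2 * t ℕ.≤? n
... | yes 2t≤n = contradiction 2t≤n 2t≰n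
... | no _     = refl

odBound≡ : ∀ n → odBound n ≡ sumTo (n ∸ 1) (λ t → 2 * term n t)
odBound≡ n = double (n ∸ 1)
  where
  double : ∀ m → 2 * sumTo m (term n) ≡ sumTo m (λ t → 2 * term n t)
  double zero    = refl
  double (suc m) = trans (ℕₚ.*-distribˡ-+ 2 (sumTo m (term n)) (term n (suc m))) (cong (_+ 2 * term n (suc m)) (double m))

sumTo-mono : ∀ m {f g} → (∀ t → 1 ≤ t → t ≤ m → f t ≤ g t) → sumTo m f ≤ sumTo m g
sumTo-mono zero    f≤g = z≤n
sumTo-mono (suc m) f≤g = ℕₚ.+-mono-≤ (sumTo-mono m λ t 1≤t t≤m → f≤g t 1≤t (ℕₚ.m≤n⇒m≤1+n t≤m)) (f≤g (suc m) (s≤s z≤n) ℕₚ.≤-refl)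

-- Totals without slack leave no slack in any term. This turns an optimal flag distance into an
-- optimal subspace distance at each dimension.
sumTo-tight : ∀ m {f g} → (∀ t → 1 ≤ t → t ≤ m → f t ≤ g t) → sumTo m g ≤ sumTo m f →
              ∀ t → 1 ≤ t → t ≤ m → f t ≡ g t
sumTo-tight zero    f≤g sums (suc t) _ ()
sumTo-tight (suc m) {f} {g} f≤g sums t 1≤t t≤1+m with ℕₚ.m≤n⇒m<n∨m≡n t≤1+m
... | inj₁ (s≤s t≤m) = sumTo-tight m f≤g′ (ℕₚ.+-cancelʳ-≤ (g (suc m)) (sumTo m g) (sumTo m f)
  (ℕₚ.≤-trans sums (ℕₚ.+-monoʳ-≤ (sumTo m f) (f≤g (suc m) (s≤s z≤n) ℕₚ.≤-refl)))) t 1≤t t≤m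
  where
  f≤g′ : ∀ t → 1 ≤ t → t ≤ m → f t ≤ g t
  f≤g′ t 1≤t t≤m = f≤g t 1≤t (ℕₚ.m≤n⇒m≤1+n t≤m)
... | inj₂ refl = ℕₚ.≤-antisym (f≤g (suc m) 1≤t ℕₚ.≤-refl) (ℕₚ.+-cancelˡ-≤ (sumTo m g) _ _
  (ℕₚ.≤-trans sums (ℕₚ.+-monoˡ-≤ (f (suc m)) (sumTo-mono m λ t 1≤t t≤m → f≤g t 1≤t (ℕₚ.m≤n⇒m≤1+n t≤m)))))

-- Subspace and flag distances, and when they are maximal.

module SubspaceDistance (F : FiniteField) where
  open Dimension F

  2*≡ : ∀ t → t + t ≡ 2 * t
  2*≡ t = cong (t +_) (sym (ℕₚ.+-identityʳ t))

  subDist-exists : ∀ {n d e} {P Q : Subspace n} → HasDim P d → HasDim Q e → ∃ (SubDist P Q)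
  subDist-exists dP dQ with dim-+-∩ dP dQ
  ... | s , t , _ , d+ , d∩ = s ∸ t , s , t , d+ , d∩ , refl

  ≐-refl : ∀ {n} {P : Subspace n} → P ≐ˢ P
  ≐-refl = (λ _ → id) , (λ _ → id)

  dims-+-∩ : ∀ {n d e s t} {P Q : Subspace n} → HasDim P d → HasDim Q e →
             HasDim (P +ˢ Q) s → HasDim (P ∩ˢ Q) t → s + t ≡ d + e
  dims-+-∩ dP dQ d+ d∩ with dim-+-∩ dP dQ
  ... | s , t , s+t , d+′ , d∩′ = trans (cong₂ _+_ (dim-unique d+ d+′ ≐-refl) (dim-unique d∩ d∩′ ≐-refl)) s+t

  -- Both bounds come from `s + i = 2t`, with `s` and `i` the dimensions of sum and intersection:
  -- `s ∸ i` is at most `s + i`, and `s ≤ n` makes it at most `2 (n ∸ t)`.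
  subDist-≤ : ∀ {n t d} {P Q : Subspace n} → t ≤ n → HasDim P t → HasDim Q t → SubDist P Q d → d ≤ 2 * term n t
  subDist-≤ {n} {t} t≤n dP dQ (s , i , d+ , d∩ , refl) = bound (2 * t ℕ.≤? n)
    where
    open ℕₚ.≤-Reasoning
    rearrange : ∀ x u → x + u + (x + u) ≡ x + x + 2 * u
    rearrange = solve-∀
    bound : Dec (2 * t ≤ n) → s ∸ i ≤ 2 * term n t
    bound (yes 2t≤n) = subst (λ x → s ∸ i ≤ 2 * x) (sym (term-≤ n t 2t≤n)) (begin
      s ∸ i   ≤⟨ ℕₚ.m∸n≤m s i ⟩
      s       ≤⟨ ℕₚ.m≤m+n s i ⟩
      s + i   ≡⟨ dims-+-∩ dP dQ d+ d∩ ⟩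
      t + t   ≡⟨ 2*≡ t ⟩
      2 * t   ∎)
    bound (no 2t≰n) = subst (λ x → s ∸ i ≤ 2 * x) (sym (term-> n t 2t≰n)) (ℕₚ.m≤n+o⇒m∸n≤o s i (ℕₚ.+-cancelˡ-≤ s _ _ (begin
      s + s                              ≤⟨ ℕₚ.+-mono-≤ (dim≤n d+) (dim≤n d+) ⟩
      n + n                              ≡⟨ cong₂ _+_ (ℕₚ.m+[n∸m]≡n t≤n) (ℕₚ.m+[n∸m]≡n t≤n) ⟨
      t + (n ∸ t) + (t + (n ∸ t))        ≡⟨ rearrange t (n ∸ t) ⟩
      t + t + 2 * (n ∸ t)                ≡⟨ cong (_+ 2 * (n ∸ t)) (dims-+-∩ dP dQ d+ d∩) ⟨
      s + i + 2 * (n ∸ t)                ≡⟨ ℕₚ.+-assoc s i _ ⟩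
      s + (i + 2 * (n ∸ t))              ∎)))

  ∩-null⇒optimal : ∀ {n t d} {P Q : Subspace n} → 2 * t ≤ n → HasDim P t → HasDim Q t →
                   (∀ v → (P ∩ˢ Q) v → v ≋ 0ᵥ) → SubDist P Q d → 2 * term n t ≤ d
  ∩-null⇒optimal {n} {t} 2t≤n dP dQ null (s , i , d+ , d∩ , refl) with null⇒dim-0 d∩ null
  ... | refl = ℕₚ.≤-reflexive (begin
    2 * term n t   ≡⟨ cong (2 *_) (term-≤ n t 2t≤n) ⟩
    2 * t          ≡⟨ 2*≡ t ⟨
    t + t          ≡⟨ dims-+-∩ dP dQ d+ d∩ ⟨
    s + 0          ≡⟨ ℕₚ.+-identityʳ s ⟩
    s              ∎)
    where open ≡-Reasoning

  +-full⇒optimal : ∀ {n t d} {P Q : Subspace n} → t ≤ n → ¬ (2 * t ≤ n) → HasDim P t → HasDim Q t →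
                   (∀ v → (P +ˢ Q) v) → SubDist P Q d → 2 * term n t ≤ d
  +-full⇒optimal {n} {t} t≤n 2t≰n dP dQ full (s , i , d+ , d∩ , refl)
    with dim-unique d+ (dim-full n) ((λ _ _ → refl) , (λ v _ → full v))
  ... | refl = ℕₚ.≤-reflexive (sym (begin
    n ∸ i                       ≡⟨ cong (_∸ i) n≡ ⟩
    2 * (n ∸ t) + i ∸ i         ≡⟨ ℕₚ.m+n∸n≡m _ i ⟩
    2 * (n ∸ t)                 ≡⟨ cong (2 *_) (term-> n t 2t≰n) ⟨
    2 * term n t                ∎))
    where
    open ≡-Reasoning
    t+u≡n : t + (n ∸ t) ≡ n
    t+u≡n = ℕₚ.m+[n∸m]≡n t≤n
    u+i≡t : (n ∸ t) + i ≡ t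
    u+i≡t = ℕₚ.+-cancelˡ-≡ t _ _ (begin
      t + ((n ∸ t) + i)     ≡⟨ ℕₚ.+-assoc t _ i ⟨
      t + (n ∸ t) + i       ≡⟨ cong (_+ i) t+u≡n ⟩
      n + i                 ≡⟨ dims-+-∩ dP dQ d+ d∩ ⟩
      t + t                 ∎)
    rearrange : ∀ u x → u + x + u ≡ 2 * u + x
    rearrange = solve-∀
    n≡ : n ≡ 2 * (n ∸ t) + i
    n≡ = begin
      n                         ≡⟨ t+u≡n ⟨
      t + (n ∸ t)               ≡⟨ cong (_+ (n ∸ t)) u+i≡t ⟨
      (n ∸ t) + i + (n ∸ t)     ≡⟨ rearrange (n ∸ t) i ⟩
      2 * (n ∸ t) + i           ∎

  optimal⇒∩-null : ∀ {n t} {P Q : Subspace n} → 2 * t ≤ n → HasDim P t → HasDim Q t →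
                   SubDist P Q (2 * term n t) → HasDim (P ∩ˢ Q) 0
  optimal⇒∩-null {n} {t} {P} {Q} 2t≤n dP dQ (s , i , d+ , d∩ , eq) = subst (HasDim (P ∩ˢ Q)) i≡0 d∩
    where
    open ℕₚ.≤-Reasoning
    i≡0 : i ≡ 0
    i≡0 = ℕₚ.n≤0⇒n≡0 (ℕₚ.+-cancelˡ-≤ s i 0 (begin
      s + i          ≡⟨ dims-+-∩ dP dQ d+ d∩ ⟩
      t + t          ≡⟨ 2*≡ t ⟩
      2 * t          ≡⟨ cong (2 *_) (term-≤ n t 2t≤n) ⟨
      2 * term n t   ≡⟨ eq ⟩
      s ∸ i          ≤⟨ ℕₚ.m∸n≤m s i ⟩
      s              ≡⟨ ℕₚ.+-identityʳ s ⟨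
      s + 0          ∎))

  -- From `s − i = 2 (n − t)` and `s + i = 2t` follows `(n − t) + i = t`. The conclusion is stated
  -- additively, away from truncated subtraction.
  optimal⇒∩-dim : ∀ {n t} {P Q : Subspace n} → t < n → ¬ (2 * t ≤ n) → HasDim P t → HasDim Q t →
                  SubDist P Q (2 * term n t) → Σ[ i ∈ ℕ ] (n + i ≡ t + t × HasDim (P ∩ˢ Q) i)
  optimal⇒∩-dim {n} {t} t<n 2t≰n dP dQ (s , i , d+ , d∩ , eq) = i , n+i≡2t , d∩
    where
    open ≡-Reasoning
    u = n ∸ t
    2u≡s∸i : 2 * u ≡ s ∸ i
    2u≡s∸i = trans (cong (2 *_) (sym (term-> n t 2t≰n))) eq
    -- Since `∸` truncates, this has to be established before `s ∸ i + i` collapses; `t < n` makes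
    -- the distance positive.
    i≤s : i ≤ s
    i≤s = ℕₚ.<⇒≤ (ℕₚ.m∸n≢0⇒n<m λ s∸i≡0 →
      ℕₚ.<⇒≢ (ℕₚ.*-monoʳ-< 2 (ℕₚ.m<n⇒0<n∸m t<n)) (sym (trans 2u≡s∸i s∸i≡0)))
    rearrange : ∀ u i → 2 * (u + i) ≡ 2 * u + i + i
    rearrange = solve-∀
    u+i≡t : u + i ≡ t
    u+i≡t = ℕₚ.*-cancelˡ-≡ (u + i) t 2 (begin
      2 * (u + i)       ≡⟨ rearrange u i ⟩
      2 * u + i + i     ≡⟨ cong (λ x → x + i + i) 2u≡s∸i ⟩
      s ∸ i + i + i     ≡⟨ cong (_+ i) (ℕₚ.m∸n+n≡m i≤s) ⟩
      s + i             ≡⟨ dims-+-∩ dP dQ d+ d∩ ⟩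
      t + t             ≡⟨ 2*≡ t ⟩
      2 * t             ∎)
    n+i≡2t : n + i ≡ t + t
    n+i≡2t = begin
      n + i             ≡⟨ cong (_+ i) (ℕₚ.m+[n∸m]≡n (ℕₚ.<⇒≤ t<n)) ⟨
      t + u + i         ≡⟨ ℕₚ.+-assoc t u i ⟩
      t + (u + i)       ≡⟨ cong (t +_) u+i≡t ⟩
      t + t             ∎

  HasDims : ∀ n → Flag n → Set
  HasDims n 𝓕 = ∀ t → 1 ≤ t → t < n → HasDim (𝓕 t) t

  subDist-≐ : ∀ {n d} {P P′ Q Q′ : Subspace n} → P ≐ˢ P′ → Q ≐ˢ Q′ → SubDist P Q d → SubDist P′ Q′ d
  subDist-≐ P≐P′ Q≐Q′ (s , t , d+ , d∩ , eq) =
    s , t , dim-≐ (+ˢ-cong P≐P′ Q≐Q′) d+ , dim-≐ (∩ˢ-cong P≐P′ Q≐Q′) d∩ , eq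

  flagEq-sym : ∀ {n} {𝓕 𝓖 : Flag n} → FlagEq n 𝓕 𝓖 → FlagEq n 𝓖 𝓕
  flagEq-sym eq t 1≤t t<n = ≐-sym (eq t 1≤t t<n)

  flagEq-trans : ∀ {n} {𝓕 𝓖 𝓗 : Flag n} → FlagEq n 𝓕 𝓖 → FlagEq n 𝓖 𝓗 → FlagEq n 𝓕 𝓗
  flagEq-trans eq eq′ t 1≤t t<n = ≐-trans (eq t 1≤t t<n) (eq′ t 1≤t t<n)

  flagDist-≐ : ∀ {n d} {𝓕 𝓕′ 𝓖 𝓖′ : Flag n} → FlagEq n 𝓕 𝓕′ → FlagEq n 𝓖 𝓖′ → FlagDist n 𝓕 𝓖 d → FlagDist n 𝓕′ 𝓖′ d
  flagDist-≐ eq eq′ (ds , dist , d≡) =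
    ds , (λ t 1≤t t<n → subDist-≐ (eq t 1≤t t<n) (eq′ t 1≤t t<n) (dist t 1≤t t<n)) , d≡

  flagDist-exists : ∀ {n} {𝓕 𝓖 : Flag n} → HasDims n 𝓕 → HasDims n 𝓖 → ∃ (FlagDist n 𝓕 𝓖)
  flagDist-exists {n} {𝓕} {𝓖} dims dims′ = sumTo (n ∸ 1) (proj₁ ∘ dist) , proj₁ ∘ dist , proj₂ ∘ dist , refl
    where
    dist : ∀ t → Σ[ d ∈ ℕ ] (1 ≤ t → t < n → SubDist (𝓕 t) (𝓖 t) d)
    dist t with 1 ℕ.≤? t | t ℕ.<? n
    ... | yes 1≤t | yes t<n = let d , sd = subDist-exists (dims t 1≤t t<n) (dims′ t 1≤t t<n) in d , λ _ _ → sd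
    -- Outside the dimensions 1 to n - 1 the value 0 is a default that the sum never reads.
    ... | no 1≰t  | _       = 0 , λ 1≤t _ → contradiction 1≤t 1≰t
    ... | yes _   | no t≮n  = 0 , λ _ t<n → contradiction t<n t≮n

  ≤∸1⇒< : ∀ {n t} → 1 ≤ t → t ≤ n ∸ 1 → t < n
  ≤∸1⇒< {zero}  (s≤s _) ()
  ≤∸1⇒< {suc n} _ t≤n = s≤s t≤n

  flagDist-≤ : ∀ {n d} {𝓕 𝓖 : Flag n} → HasDims n 𝓕 → HasDims n 𝓖 → FlagDist n 𝓕 𝓖 d → d ≤ odBound n
  flagDist-≤ {n} dims dims′ (ds , dist , refl) = ℕₚ.≤-trans
    (sumTo-mono (n ∸ 1) λ t 1≤t t≤n-1 → let t<n = ≤∸1⇒< 1≤t t≤n-1 in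
      subDist-≤ (ℕₚ.<⇒≤ t<n) (dims t 1≤t t<n) (dims′ t 1≤t t<n) (dist t 1≤t t<n))
    (ℕₚ.≤-reflexive (sym (odBound≡ n)))

  flagDist-≥ : ∀ {n d} {𝓕 𝓖 : Flag n} →
    (∀ t → 1 ≤ t → t < n → ∀ {d} → SubDist (𝓕 t) (𝓖 t) d → 2 * term n t ≤ d) → FlagDist n 𝓕 𝓖 d → odBound n ≤ d
  flagDist-≥ {n} optimal (ds , dist , refl) = ℕₚ.≤-trans (ℕₚ.≤-reflexive (odBound≡ n))
    (sumTo-mono (n ∸ 1) λ t 1≤t t≤n-1 → let t<n = ≤∸1⇒< 1≤t t≤n-1 in optimal t 1≤t t<n (dist t 1≤t t<n))

  flagDist-tight : ∀ {n d} {𝓕 𝓖 : Flag n} → HasDims n 𝓕 → HasDims n 𝓖 → FlagDist n 𝓕 𝓖 d → odBound n ≤ d →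
    ∀ t → 1 ≤ t → t < n → SubDist (𝓕 t) (𝓖 t) (2 * term n t)
  flagDist-tight {n} {𝓕 = 𝓕} {𝓖} dims dims′ (ds , dist , refl) od≤d t 1≤t t<n =
    subst (SubDist (𝓕 t) (𝓖 t))
      (sumTo-tight (n ∸ 1) (λ t 1≤t t≤n-1 → let t<n = ≤∸1⇒< 1≤t t≤n-1 in
          subDist-≤ (ℕₚ.<⇒≤ t<n) (dims t 1≤t t<n) (dims′ t 1≤t t<n) (dist t 1≤t t<n))
        (ℕₚ.≤-trans (ℕₚ.≤-reflexive (sym (odBound≡ n))) od≤d) t 1≤t (ℕₚ.≤-pred (subst (t <_) (sym (suc[n∸1] t<n)) t<n)))
      (dist t 1≤t t<n)
    where
    suc[n∸1] : ∀ {t n} → t < n → suc (n ∸ 1) ≡ n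
    suc[n∸1] (s≤s _) = refl

  flag-chain : ∀ {n s} {𝓕 : Flag n} → IsFullFlag n 𝓕 → 1 ≤ s → ∀ {t} → s ≤ t → t < n → 𝓕 s ⊆ˢ 𝓕 t
  flag-chain {n} {s} {𝓕} full 1≤s {t} s≤t t<n with ℕₚ.m≤n⇒m<n∨m≡n s≤t
  ... | inj₂ refl = λ _ → id
  flag-chain {n} {s} {𝓕} full 1≤s {suc t} s≤t t<n | inj₁ (s≤s s≤t′) = λ v v∈ →
    proj₂ (full t (ℕₚ.≤-trans 1≤s s≤t′) (ℕₚ.<-trans ℕₚ.≤-refl t<n)) t<n v
      (flag-chain full 1≤s s≤t′ (ℕₚ.<-trans ℕₚ.≤-refl t<n) v v∈)

  dim-·ˢ : ∀ {n d} {P : Subspace n} {A : Mat n n} → LinIndepRows A → HasDim P d → HasDim (P ·ˢ A) d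
  dim-·ˢ {A = A} A-indep (B , B-indep , P⊆B , B⊆P) =
    B ·ₘ A ,
    (λ c eq → B-indep c (A-indep (c ·ᵥ B) (λ j → trans (·ᵥ-assoc c B A j) (eq j)))) ,
    (λ w (v , p , w≋vA) → let (c , v≋cB) = P⊆B v p in
      c , λ j → trans (w≋vA j) (trans (·ᵥ-congˡ A v≋cB j) (·ᵥ-assoc c B A j))) ,
    (λ w (c , w≋) → c ·ᵥ B , B⊆P _ (c , λ _ → refl) , λ j → trans (w≋ j) (sym (·ᵥ-assoc c B A j)))

  null-closed : ∀ {n} → Closed {n} (_≋ 0ᵥ)
  null-closed = record
    { resp-≋ = λ v≋w v≋0 j → trans (sym (v≋w j)) (v≋0 j)
    ; add    = λ v≋0 w≋0 j → trans (cong₂ _+F_ (v≋0 j) (w≋0 j)) (+-identityˡ 0F)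
    ; scale  = λ s v≋0 j → trans (cong (s *F_) (v≋0 j)) (zeroʳ s)
    }

  -- One of the first two basis vectors serves. If `p` has zero first coordinate, take the first
  -- vector; otherwise take the second, since the first coordinate of a relation forces `t` to
  -- vanish. Only `s ≡ 0F` is claimed, so that `p` may be zero.
  independent-partner : ∀ {n d p} {P : Subspace n} → HasDim P d → 1 < d → P p →
    Σ[ p′ ∈ Vec n ] (P p′ × (∀ s t → s ⊙ p′ ⊕ t ⊙ p ≋ 0ᵥ → s ≡ 0F))
  independent-partner {d = suc zero} _ (s≤s ())
  independent-partner {n} {suc (suc d)} {p} {P} (B , B-indep , P⊆B , B⊆P) _ p∈P = partner (c zero ≟F 0F)
    where
    open ≡-Reasoning
    c = proj₁ (P⊆B p p∈P)
    i₀ i₁ : Fin (suc (suc d))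
    i₀ = zero
    i₁ = suc zero
    coordinates : ∀ i s t → s ⊙ B i ⊕ t ⊙ p ≋ 0ᵥ → s ⊙ δ i ⊕ t ⊙ c ≋ 0ᵥ
    coordinates i s t eq = B-indep _ λ j → begin
      ((s ⊙ δ i ⊕ t ⊙ c) ·ᵥ B) j                     ≡⟨ ·ᵥ-distrib-⊕ (s ⊙ δ i) (t ⊙ c) B j ⟩
      ((s ⊙ δ i) ·ᵥ B) j +F ((t ⊙ c) ·ᵥ B) j         ≡⟨ cong₂ _+F_ (·ᵥ-⊙ s (δ i) B j) (·ᵥ-⊙ t c B j) ⟩
      s *F (δ i ·ᵥ B) j +F t *F (c ·ᵥ B) j           ≡⟨ cong₂ (λ x y → s *F x +F t *F y) (δ-·ᵥ i B j) (sym (proj₂ (P⊆B p p∈P) j)) ⟩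
      s *F B i j +F t *F p j                         ≡⟨ eq j ⟩
      0F                                             ∎
    diagonal : ∀ i s t → t *F c i ≡ 0F → s ⊙ δ i ⊕ t ⊙ c ≋ 0ᵥ → s ≡ 0F
    diagonal i s t tcᵢ≡0 eq = begin
      s                          ≡⟨ *-identityʳ s ⟨
      s *F 1F                    ≡⟨ cong (s *F_) (δ-≡ i i refl) ⟨
      s *F δ i i                 ≡⟨ +-identityʳ _ ⟨
      s *F δ i i +F 0F           ≡⟨ cong (s *F δ i i +F_) tcᵢ≡0 ⟨
      s *F δ i i +F t *F c i     ≡⟨ eq i ⟩
      0F                         ∎
    partner : Dec (c zero ≡ 0F) → Σ[ p′ ∈ Vec n ] (P p′ × (∀ s t → s ⊙ p′ ⊕ t ⊙ p ≋ 0ᵥ → s ≡ 0F))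
    partner (yes c₀≡0) = B i₀ , B⊆P _ (rowsp-row B i₀) , λ s t eq →
      diagonal i₀ s t (trans (cong (t *F_) c₀≡0) (zeroʳ t)) (coordinates i₀ s t eq)
    partner (no c₀≢0) = B i₁ , B⊆P _ (rowsp-row B i₁) , λ s t eq →
      diagonal i₁ s t (trans (cong (_*F c i₁) (t≡0 s t (coordinates i₁ s t eq))) (zeroˡ (c i₁))) (coordinates i₁ s t eq)
      where
      t≡0 : ∀ s t → s ⊙ δ i₁ ⊕ t ⊙ c ≋ 0ᵥ → t ≡ 0F
      -- The scalar `t` is treated as a vector of length 1 so that a nonzero factor can be
      -- cancelled.
      t≡0 s t eq = cancel-scalar (null-closed {1}) {v = λ _ → t} c₀≢0 (λ _ → begin
        c zero *F t                        ≡⟨ *-comm (c zero) t ⟩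
        t *F c zero                        ≡⟨ +-identityˡ _ ⟨
        0F +F t *F c zero                  ≡⟨ cong (_+F t *F c zero) (zeroʳ s) ⟨
        s *F δ i₁ i₀ +F t *F c zero        ≡⟨ eq zero ⟩
        0F                                 ∎) zero

-- The action of the block matrix on left and right components.

module BlockAction (F : FiniteField) (k : ℕ) (a : Ops.Vec F (suc k)) (prim : Ops.IsPrimitive F a) where
  open PrimitiveCompanion F k a prim public
  open SubspaceDistance F public

  n : ℕ
  n = k + suc k

  g : Mat n n
  g = blockDiag I M

  L : Vec n → Vec k
  L v = v ∘ (_↑ˡ suc k)

  R : Vec n → Vec (suc k)
  R v = v ∘ (k ↑ʳ_)

  L-R-ext : ∀ {v w} → L v ≋ L w → R v ≋ R w → v ≋ w
  L-R-ext {v} {w} l r j = subst (λ j → v j ≡ w j) (Finₚ.join-splitAt k (suc k) j) (go (splitAt k j))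
    where
    go : ∀ s → v (Fin.join k (suc k) s) ≡ w (Fin.join k (suc k) s)
    go (inj₁ i) = l i
    go (inj₂ i) = r i

  g-LL : ∀ i j → g (i ↑ˡ suc k) (j ↑ˡ suc k) ≡ I i j
  g-LL i j rewrite Finₚ.splitAt-↑ˡ k i (suc k) | Finₚ.splitAt-↑ˡ k j (suc k) = refl

  g-RL : ∀ i j → g (k ↑ʳ i) (j ↑ˡ suc k) ≡ 0F
  g-RL i j rewrite Finₚ.splitAt-↑ʳ k (suc k) i | Finₚ.splitAt-↑ˡ k j (suc k) = refl

  g-LR : ∀ i j → g (i ↑ˡ suc k) (k ↑ʳ j) ≡ 0F
  g-LR i j rewrite Finₚ.splitAt-↑ˡ k i (suc k) | Finₚ.splitAt-↑ʳ k (suc k) j = refl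

  g-RR : ∀ i j → g (k ↑ʳ i) (k ↑ʳ j) ≡ M i j
  g-RR i j rewrite Finₚ.splitAt-↑ʳ k (suc k) i | Finₚ.splitAt-↑ʳ k (suc k) j = refl

  L-g : ∀ v → L (v ·ᵥ g) ≋ L v
  L-g v j = begin
    (v ·ᵥ g) (j ↑ˡ suc k)
      ≡⟨ ∑-split k (λ i → v i *F g i (j ↑ˡ suc k)) ⟩
    ∑ (λ i → L v i *F g (i ↑ˡ suc k) (j ↑ˡ suc k)) +F ∑ (λ i → R v i *F g (k ↑ʳ i) (j ↑ˡ suc k))
      ≡⟨ cong₂ _+F_ (∑-cong (λ i → cong (L v i *F_) (g-LL i j))) (trans (∑-cong (λ i → trans (cong (R v i *F_) (g-RL i j)) (zeroʳ (R v i)))) (∑-zero (suc k))) ⟩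
    (L v ·ᵥ I) j +F 0F
      ≡⟨ trans (+-identityʳ _) (·ᵥ-identity (L v) j) ⟩
    L v j ∎
    where open ≡-Reasoning

  R-g : ∀ v → R (v ·ᵥ g) ≋ R v ·ᵥ M
  R-g v j = begin
    (v ·ᵥ g) (k ↑ʳ j)
      ≡⟨ ∑-split k (λ i → v i *F g i (k ↑ʳ j)) ⟩
    ∑ (λ i → L v i *F g (i ↑ˡ suc k) (k ↑ʳ j)) +F ∑ (λ i → R v i *F g (k ↑ʳ i) (k ↑ʳ j))
      ≡⟨ cong₂ _+F_ (trans (∑-cong (λ i → trans (cong (L v i *F_) (g-LR i j)) (zeroʳ (L v i)))) (∑-zero k)) (∑-cong (λ i → cong (R v i *F_) (g-RR i j))) ⟩
    0F +F (R v ·ᵥ M) j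
      ≡⟨ +-identityˡ _ ⟩
    (R v ·ᵥ M) j ∎
    where open ≡-Reasoning

  infixl 8 _▹_

  _▹_ : Vec n → ℕ → Vec n
  v ▹ e = v ·ᵥ g ^ₘ e

  L-▹ : ∀ e v → L (v ▹ e) ≋ L v
  L-▹ zero    v j = ·ᵥ-identity v (j ↑ˡ suc k)
  L-▹ (suc e) v j = trans (sym (·ᵥ-assoc v g (g ^ₘ e) (j ↑ˡ suc k))) (trans (L-▹ e (v ·ᵥ g) j) (L-g v j))

  R-▹ : ∀ e v → R (v ▹ e) ≋ R v ·ᵥ M ^ₘ e
  R-▹ zero    v j = trans (·ᵥ-identity v (k ↑ʳ j)) (sym (·ᵥ-identity (R v) j))
  R-▹ (suc e) v j = begin
    R (v ▹ suc e) j              ≡⟨ ·ᵥ-assoc v g (g ^ₘ e) (k ↑ʳ j) ⟨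
    R ((v ·ᵥ g) ▹ e) j           ≡⟨ R-▹ e (v ·ᵥ g) j ⟩
    (R (v ·ᵥ g) ·ᵥ M ^ₘ e) j     ≡⟨ ·ᵥ-congˡ (M ^ₘ e) (R-g v) j ⟩
    (R v ·ᵥ M ·ᵥ M ^ₘ e) j       ≡⟨ ·ᵥ-assoc (R v) M (M ^ₘ e) j ⟩
    (R v ·ᵥ M ^ₘ suc e) j        ∎
    where open ≡-Reasoning

  ▹-indep : ∀ e → LinIndepRows (g ^ₘ e)
  ▹-indep e v eq = L-R-ext
    (λ j → trans (sym (L-▹ e v j)) (eq (j ↑ˡ suc k)))
    (M^-indep e (R v) (λ j → trans (sym (R-▹ e v j)) (eq (k ↑ʳ j))))

  -- `residue` records how a power of `M` acts on one nonzero vector; by rigidity this determines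
  -- its action on every right component, while left components never change.
  ▹-cong : ∀ i j → residue i ≋ residue j → ∀ v → v ▹ i ≋ v ▹ j
  ▹-cong i j eq v = L-R-ext
    (λ l → trans (L-▹ i v l) (sym (L-▹ j v l)))
    (λ l → trans (R-▹ i v l) (trans (rigid₁ i j (residue≢0 0 ∘ λ δ≋0 l → trans (residue-0 l) (δ≋0 l)) eq (R v) l) (sym (R-▹ j v l))))

  ▹-fix : ∀ e {v} → R v ≋ 0ᵥ → v ▹ e ≋ v
  ▹-fix e {v} Rv≋0 = L-R-ext (L-▹ e v) λ j → trans (R-▹ e v j)
    (trans (·ᵥ-congˡ (M ^ₘ e) Rv≋0 j) (trans (·ᵥ-zeroˡ (M ^ₘ e) j) (sym (Rv≋0 j))))

  ▹-move : ∀ {v w} → L v ≋ L w → ¬ (R v ≋ 0ᵥ) → ¬ (R w ≋ 0ᵥ) → Σ[ j ∈ ℕ ] (v ▹ j ≋ w)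
  ▹-move {v} {w} Lv≋Lw Rv≢0 Rw≢0 = j , L-R-ext
    (λ l → trans (L-▹ j v l) (Lv≋Lw l))
    (λ l → trans (R-▹ j v l) (proj₂ (transitive Rv≢0 Rw≢0) l))
    where j = proj₁ (transitive Rv≢0 Rw≢0)

  ·ˢ-⊆-resp : ∀ i j {P : Subspace n} → (∀ v → v ▹ i ≋ v ▹ j) → (P ·ˢ (g ^ₘ i)) ⊆ˢ (P ·ˢ (g ^ₘ j))
  ·ˢ-⊆-resp i j eq w (v , p , w≋) = v , p , λ l → trans (w≋ l) (eq v l)

  residue-≡⇒flagEq : ∀ i j {𝓕 : Flag n} → residue i ≋ residue j → FlagEq n (𝓕 ·ᶠ (g ^ₘ i)) (𝓕 ·ᶠ (g ^ₘ j))
  residue-≡⇒flagEq i j eq t _ _ =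
    ·ˢ-⊆-resp i j (▹-cong i j eq) , ·ˢ-⊆-resp j i (▹-cong j i (λ l → sym (eq l)))

  g^N≈I : (g ^ₘ N) ≈ₘ I
  g^N≈I i j = trans (sym (δ-·ᵥ i (g ^ₘ N) j)) (L-R-ext
    (L-▹ N (δ i))
    (λ l → trans (R-▹ N (δ i) l) (period (R (δ i)) l)) j)

  -- Minimality is inherited from the polynomial: evaluated at `(0, δ zero)`, the equation `g^e = I`
  -- says that x^e has remainder 1.
  group-order : GroupOrder g N
  group-order = (0<N , g^N≈I) , λ e (0<e , g^e≈I) → order-least e 0<e λ l → begin
    residue e l                         ≡⟨ ·ᵥ-congˡ (M ^ₘ e) (lookup-++ʳ 0ᵥ′ (δ zero)) l ⟨
    (R (0ᵥ′ ++ δ zero) ·ᵥ M ^ₘ e) l     ≡⟨ R-▹ e (0ᵥ′ ++ δ zero) l ⟨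
    R ((0ᵥ′ ++ δ zero) ▹ e) l           ≡⟨ ·ᵥ-congʳ (0ᵥ′ ++ δ zero) g^e≈I (k ↑ʳ l) ⟩
    R ((0ᵥ′ ++ δ zero) ·ᵥ I) l          ≡⟨ ·ᵥ-identity (0ᵥ′ ++ δ zero) (k ↑ʳ l) ⟩
    R (0ᵥ′ ++ δ zero) l                 ≡⟨ lookup-++ʳ 0ᵥ′ (δ zero) l ⟩
    δ zero l                            ∎
    where
    open ≡-Reasoning
    0ᵥ′ : Vec k
    0ᵥ′ = 0ᵥ

  InjectiveOn SurjectiveOn : ∀ {m} → Subspace n → (Vec n → Vec m) → Set
  InjectiveOn P π = ∀ v → P v → π v ≋ 0ᵥ → v ≋ 0ᵥ
  SurjectiveOn P π = ∀ x → Σ[ v ∈ Vec n ] (P v × π v ≋ x)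

  L-hcat : ∀ {m} (A : Mat m k) (B : Mat m (suc k)) c → L (c ·ᵥ hcat A B) ≋ c ·ᵥ A
  L-hcat A B c j = ∑-cong (λ i → cong (c i *F_) (lookup-++ˡ (A i) (B i) j))

  R-hcat : ∀ {m} (A : Mat m k) (B : Mat m (suc k)) c → R (c ·ᵥ hcat A B) ≋ c ·ᵥ B
  R-hcat A B c j = ∑-cong (λ i → cong (c i *F_) (lookup-++ʳ (A i) (B i) j))

  -- In the basis formed by the rows of `H`, `A` is the matrix of the projection `π` restricted to
  -- `P`. It is applied to `U₁` with the left projection and to `V₂` with the right one, the two
  -- blocks that are square.
  module SquareBlock {m : ℕ} (P : Subspace n) (H : Mat m n) (P≐ : P ≐ˢ InRowsp H) (A : Mat m m)
    (π : Vec n → Vec m) (π-cong : ∀ {v w} → v ≋ w → π v ≋ π w) (π-H : ∀ c → π (c ·ᵥ H) ≋ c ·ᵥ A) where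

    injective⇒invertible : HasRank H m → InjectiveOn P π → Invertible A
    injective⇒invertible rank inj = indep⇒invertible {A = A} λ c cA≋0 → full-rank⇒indep {A = H} rank c
      (inj _ (proj₂ P≐ _ (c , λ _ → refl)) (λ j → trans (π-H c j) (cA≋0 j)))

    invertible⇒injective : Invertible A → InjectiveOn P π
    invertible⇒injective inv v v∈P πv≋0 j = begin
      v j           ≡⟨ proj₂ v∈ j ⟩
      (c ·ᵥ H) j    ≡⟨ ·ᵥ-congˡ H (invertible⇒indep {A = A} inv c cA≋0) j ⟩
      (0ᵥ ·ᵥ H) j   ≡⟨ ·ᵥ-zeroˡ H j ⟩
      0F            ∎
      where
      open ≡-Reasoning
      v∈ = proj₁ P≐ v v∈P
      c = proj₁ v∈
      cA≋0 : c ·ᵥ A ≋ 0ᵥ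
      cA≋0 j = trans (sym (π-H c j)) (trans (sym (π-cong (proj₂ v∈) j)) (πv≋0 j))

    invertible⇒surjective : Invertible A → SurjectiveOn P π
    invertible⇒surjective (W , _ , WA≈I) x = (x ·ᵥ W) ·ᵥ H , proj₂ P≐ _ (x ·ᵥ W , λ _ → refl) ,
      λ j → trans (π-H (x ·ᵥ W) j) (·ᵥ-cancel {A = W} {A} WA≈I x j)

-- The orbit of the flag.

module FlagOrbit (F : FiniteField) (k : ℕ) (1<k : 1 < k) (a : Ops.Vec F (suc k)) (prim : Ops.IsPrimitive F a)
  (𝓕 : Ops.Flag F (k + suc k)) (full : Ops.IsFullFlag F (k + suc k) 𝓕) where
  open BlockAction F k a prim public

  P Q : Subspace n
  P = 𝓕 k
  Q = 𝓕 (suc k)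

  𝓖 : ℕ → Flag n
  𝓖 e = 𝓕 ·ᶠ (g ^ₘ e)

  1≤k : 1 ≤ k
  1≤k = ℕₚ.<⇒≤ 1<k

  k<n : k < n
  k<n = ℕₚ.m≤n+m (suc k) k

  1+k<n : suc k < n
  1+k<n = ℕₚ.m<n+m (suc k) 1≤k

  dims : HasDims n 𝓕
  dims t 1≤t t<n = proj₁ (full t 1≤t t<n)

  dimP : HasDim P k
  dimP = dims k 1≤k k<n

  dimQ : HasDim Q (suc k)
  dimQ = dims (suc k) (s≤s z≤n) 1+k<n

  P-closed : Closed P
  P-closed = dim⇒closed dimP

  Q-closed : Closed Q
  Q-closed = dim⇒closed dimQ

  module P = Closed P-closed
  module Q = Closed Q-closed

  P⊆Q : P ⊆ˢ Q
  P⊆Q = proj₂ (full k 1≤k k<n) 1+k<n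

  𝓖-dims : ∀ e → HasDims n (𝓖 e)
  𝓖-dims e t 1≤t t<n = dim-·ˢ (▹-indep e) (dims t 1≤t t<n)

  2*k≤n : 2 * k ≤ n
  2*k≤n = subst (_≤ n) (2*≡ k) (ℕₚ.+-monoʳ-≤ k (ℕₚ.n≤1+n k))

  2*t≤n : ∀ {t} → t ≤ k → 2 * t ≤ n
  2*t≤n t≤k = ℕₚ.≤-trans (ℕₚ.*-monoʳ-≤ 2 t≤k) 2*k≤n

  2*t≰n : ∀ {t} → k < t → ¬ (2 * t ≤ n)
  2*t≰n {t} k<t 2t≤n = ℕₚ.<⇒≱ (ℕₚ.+-mono-<-≤ k<t k<t) (subst (_≤ n) (sym (2*≡ t)) 2t≤n)

  sumTo-zero : ∀ m → sumTo m (λ _ → 0) ≡ 0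
  sumTo-zero zero    = refl
  sumTo-zero (suc m) = trans (ℕₚ.+-identityʳ _) (sumTo-zero m)

  -- The dimension `k` alone contributes `2 * k`. This excludes the one-flag alternative, where the
  -- minimum distance is 0 by convention.
  odBound≢0 : ¬ (odBound n ≡ 0)
  odBound≢0 eq = ℕₚ.<⇒≢ (ℕₚ.*-monoʳ-< 2 1≤k) (trans
    (sumTo-tight (n ∸ 1) (λ _ _ _ → z≤n)
      (ℕₚ.≤-reflexive (trans (sym (odBound≡ n)) (trans eq (sym (sumTo-zero (n ∸ 1)))))) k 1≤k
      (ℕₚ.≤-trans (ℕₚ.m≤m+n k k) (ℕₚ.≤-reflexive (cong (_∸ 1) (sym (ℕₚ.+-suc k k))))))
    (cong (2 *_) (term-≤ n k 2*k≤n)))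

  orbit-cycle : ∀ j → Σ[ i ∈ ℕ ] (i < N × FlagEq n (𝓖 j) (𝓖 i))
  orbit-cycle j = j % N , m%n<n j N , residue-≡⇒flagEq j (j % N) λ l → begin
    residue j l                                       ≡⟨ cong (λ e → residue e l) (m≡m%n+[m/n]*n j N) ⟩
    residue (j % N + j / N * N) l                     ≡⟨ residue-+ (j % N) (j / N * N) l ⟩
    (residue (j % N) ·ᵥ M ^ₘ (j / N * N)) l           ≡⟨ period-* (j / N) (residue (j % N)) l ⟩
    residue (j % N) l                                 ∎
    where
    open ≡-Reasoning
    instance
      N-nonZero : ℕ.NonZero N
      N-nonZero = ℕ.>-nonZero 0<N

  -- Sufficiency: bijective projections give optimum distance.

  module Sufficient (P-inj : InjectiveOn P L) (P-surj : SurjectiveOn P L)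
                    (Q-inj : InjectiveOn Q R) (Q-surj : SurjectiveOn Q R) where

    P-∩-null : ∀ i j → ¬ (residue i ≋ residue j) → ∀ v → (𝓖 i k ∩ˢ 𝓖 j k) v → v ≋ 0ᵥ
    P-∩-null i j i≢j v ((x , x∈P , v≋xgⁱ) , (y , y∈P , v≋ygʲ)) l = begin
      v l              ≡⟨ v≋xgⁱ l ⟩
      (x ▹ i) l        ≡⟨ ·ᵥ-congˡ (g ^ₘ i) x≋0 l ⟩
      (0ᵥ ▹ i) l       ≡⟨ ·ᵥ-zeroˡ (g ^ₘ i) l ⟩
      0F               ∎
      where
      open ≡-Reasoning
      Lx≋Ly : L x ≋ L y
      Lx≋Ly l = begin
        L x l         ≡⟨ L-▹ i x l ⟨
        L (x ▹ i) l   ≡⟨ v≋xgⁱ (l ↑ˡ suc k) ⟨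
        L v l         ≡⟨ v≋ygʲ (l ↑ˡ suc k) ⟩
        L (y ▹ j) l   ≡⟨ L-▹ j y l ⟩
        L y l         ∎
      x≋y : x ≋ y
      x≋y l = x-y≡0⇒x≡y _ _ (P-inj (x ⊕ ⊖ y) (P.add x∈P (P.neg y∈P)) (⊕-⊖ (L x) (L y) Lx≋Ly) l)
      RxMⁱ≋RxMʲ : R x ·ᵥ M ^ₘ i ≋ R x ·ᵥ M ^ₘ j
      RxMⁱ≋RxMʲ l = begin
        (R x ·ᵥ M ^ₘ i) l   ≡⟨ R-▹ i x l ⟨
        R (x ▹ i) l         ≡⟨ v≋xgⁱ (k ↑ʳ l) ⟨
        R v l               ≡⟨ v≋ygʲ (k ↑ʳ l) ⟩
        R (y ▹ j) l         ≡⟨ R-▹ j y l ⟩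
        (R y ·ᵥ M ^ₘ j) l   ≡⟨ ·ᵥ-congˡ (M ^ₘ j) (λ l → x≋y (k ↑ʳ l)) l ⟨
        (R x ·ᵥ M ^ₘ j) l   ∎
      x≋0 : x ≋ 0ᵥ
      x≋0 = decideR (R x ≟ᵥ 0ᵥ)
        where
        decideR : Dec (R x ≋ 0ᵥ) → x ≋ 0ᵥ
        decideR (yes Rx≋0) = Q-inj x (P⊆Q x x∈P) Rx≋0
        decideR (no Rx≢0)  = contradiction (rigid₁ i j Rx≢0 RxMⁱ≋RxMʲ (δ zero)) i≢j

    Q-+-full : ∀ i j → ¬ (residue i ≋ residue j) → ∀ v → (𝓖 i (suc k) +ˢ 𝓖 j (suc k)) v
    Q-+-full i j i≢j v =
      (p ⊕ ⊖ x) ▹ i , x ▹ j ,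
      (p ⊕ ⊖ x , Q.add (P⊆Q p p∈P) (Q.neg x∈Q) , λ _ → refl) , (x , x∈Q , λ _ → refl) ,
      L-R-ext v-L v-R
      where
      open ≡-Reasoning
      p = proj₁ (P-surj (L v))
      p∈P = proj₁ (proj₂ (P-surj (L v)))
      Lp≋Lv = proj₂ (proj₂ (P-surj (L v)))
      difference = difference-surjective i j i≢j (R v ⊕ ⊖ (R p ·ᵥ M ^ₘ i))
      e = proj₁ difference
      x = proj₁ (Q-surj e)
      x∈Q = proj₁ (proj₂ (Q-surj e))
      Rx≋e = proj₂ (proj₂ (Q-surj e))
      v-L : ∀ l → L v l ≡ L ((p ⊕ ⊖ x) ▹ i) l +F L (x ▹ j) l
      v-L l = begin
        L v l                                   ≡⟨ Lp≋Lv l ⟨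
        L p l                                   ≡⟨ x-y+y (L p l) (L x l) ⟨
        L p l +F -F L x l +F L x l              ≡⟨ cong₂ _+F_ (L-▹ i (p ⊕ ⊖ x) l) (L-▹ j x l) ⟨
        L ((p ⊕ ⊖ x) ▹ i) l +F L (x ▹ j) l      ∎
      v-R : ∀ l → R v l ≡ R ((p ⊕ ⊖ x) ▹ i) l +F R (x ▹ j) l
      v-R l = sym (begin
        R ((p ⊕ ⊖ x) ▹ i) l +F R (x ▹ j) l
          ≡⟨ cong₂ _+F_ (R-▹ i (p ⊕ ⊖ x) l) (R-▹ j x l) ⟩
        ((R p ⊕ ⊖ R x) ·ᵥ M ^ₘ i) l +F (R x ·ᵥ M ^ₘ j) l
          ≡⟨ cong₂ _+F_ (trans (·ᵥ-distrib-⊕ (R p) (⊖ R x) (M ^ₘ i) l) (cong (rp +F_) (trans (·ᵥ-⊖ (R x) (M ^ₘ i) l) (cong -F_ (·ᵥ-congˡ (M ^ₘ i) Rx≋e l))))) (trans (·ᵥ-congˡ (M ^ₘ j) Rx≋e l) (proj₂ difference l)) ⟩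
        rp +F -F ei +F (R v l +F -F rp +F ei)
          ≡⟨ +-comm _ _ ⟩
        R v l +F -F rp +F ei +F (rp +F -F ei)
          ≡⟨ cong₂ _+F_ (+-comm _ _) (+-comm _ _) ⟩
        ei +F (R v l +F -F rp) +F (-F ei +F rp)
          ≡⟨ +-interchange _ _ _ _ ⟩
        ei +F -F ei +F (R v l +F -F rp +F rp)
          ≡⟨ cong₂ _+F_ (-‿inverseʳ ei) (x-y+y (R v l) rp) ⟩
        0F +F R v l
          ≡⟨ +-identityˡ _ ⟩
        R v l ∎)
        where
        rp = (R p ·ᵥ M ^ₘ i) l
        ei = (e ·ᵥ M ^ₘ i) l

    -- Only the two middle dimensions need an argument: a trivial intersection passes down to
    -- subspaces of `P`, and a full sum passes up to spaces containing `Q`.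
    optimal : ∀ i j → ¬ (residue i ≋ residue j) → ∀ t → 1 ≤ t → t < n → ∀ {d} → SubDist (𝓖 i t) (𝓖 j t) d → 2 * term n t ≤ d
    optimal i j i≢j t 1≤t t<n = bySize (t ℕ.≤? k)
      where
      bySize : Dec (t ≤ k) → ∀ {d} → SubDist (𝓖 i t) (𝓖 j t) d → 2 * term n t ≤ d
      bySize (yes t≤k) = ∩-null⇒optimal (2*t≤n t≤k) (𝓖-dims i t 1≤t t<n) (𝓖-dims j t 1≤t t<n)
        λ { v ((x , x∈ , eq) , (y , y∈ , eq′)) → P-∩-null i j i≢j v ((x , ⊆P x x∈ , eq) , (y , ⊆P y y∈ , eq′)) }
        where
        ⊆P : 𝓕 t ⊆ˢ P
        ⊆P = flag-chain full 1≤t t≤k k<n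
      bySize (no t≰k) = +-full⇒optimal (ℕₚ.<⇒≤ t<n) (2*t≰n k<t) (𝓖-dims i t 1≤t t<n) (𝓖-dims j t 1≤t t<n)
        λ v → enlarge (Q-+-full i j i≢j v)
        where
        k<t = ℕₚ.≰⇒> t≰k
        Q⊆ : Q ⊆ˢ 𝓕 t
        Q⊆ = flag-chain full (s≤s z≤n) k<t t<n
        enlarge : ∀ {v} → (𝓖 i (suc k) +ˢ 𝓖 j (suc k)) v → (𝓖 i t +ˢ 𝓖 j t) v
        enlarge (x , y , (x₀ , x₀∈ , eqˣ) , (y₀ , y₀∈ , eqʸ) , eq) =
          x , y , (x₀ , Q⊆ x₀ x₀∈ , eqˣ) , (y₀ , Q⊆ y₀ y₀∈ , eqʸ) , eq

    𝓖-distinct : ∀ i j → ¬ (residue i ≋ residue j) → ¬ FlagEq n (𝓖 i) (𝓖 j)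
    𝓖-distinct i j i≢j eq = ℕₚ.<⇒≢ 1≤k (sym (null⇒dim-0 (𝓖-dims i k 1≤k k<n)
      λ v v∈ → P-∩-null i j i≢j v (v∈ , proj₁ (eq k 1≤k k<n) v v∈)))

    -- From `q ^ suc k > q ≥ 2`. It ensures two distinct flags in the orbit, at which the minimum is
    -- attained.
    1<N : 1 < N
    1<N = ℕₚ.≤-pred (subst (2 <_) q^m≡1+N (ℕₚ.≤-<-trans 1<q
      (subst (_< q ^ suc k) (ℕₚ.^-identityʳ q) (ℕₚ.^-monoʳ-< q 1<q (s≤s 1≤k)))))

    isOptimum : IsOptimumDistance n (Orbit 𝓕 g)
    isOptimum = lower , inj₁ (𝓖 0 , 𝓖 1 , inOrbit 0 , inOrbit 1 , 𝓖-distinct 0 1 0≢1ᵣ , attained)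
      where
      inOrbit : ∀ e → Orbit 𝓕 g (𝓖 e)
      inOrbit e = e , λ _ _ _ → ≐-refl
      0≢1ᵣ : ¬ (residue 0 ≋ residue 1)
      0≢1ᵣ eq with residue-distinct 0<N 1<N eq
      ... | ()
      lower : ∀ 𝓕₁ 𝓕₂ → Orbit 𝓕 g 𝓕₁ → Orbit 𝓕 g 𝓕₂ → ¬ FlagEq n 𝓕₁ 𝓕₂ → ∀ d → FlagDist n 𝓕₁ 𝓕₂ d → odBound n ≤ d
      lower 𝓕₁ 𝓕₂ (i , eq₁) (j , eq₂) 𝓕₁≢𝓕₂ d dist = flagDist-≥ (optimal i j i≢j) (flagDist-≐ eq₁ eq₂ dist)
        where
        i≢j : ¬ (residue i ≋ residue j)
        i≢j eq = 𝓕₁≢𝓕₂ (flagEq-trans eq₁ (flagEq-trans (residue-≡⇒flagEq i j eq) (flagEq-sym eq₂)))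
      attained : FlagDist n (𝓖 0) (𝓖 1) (odBound n)
      attained = subst (FlagDist n (𝓖 0) (𝓖 1))
        (ℕₚ.≤-antisym (flagDist-≤ (𝓖-dims 0) (𝓖-dims 1) dist) (flagDist-≥ (optimal 0 1 0≢1ᵣ) dist)) dist
        where dist = proj₂ (flagDist-exists (𝓖-dims 0) (𝓖-dims 1))

    orbit-card : OrbitCard 𝓕 g N
    orbit-card = (λ i j i<N j<N i≢j → 𝓖-distinct i j (λ eq → i≢j (residue-distinct i<N j<N eq))) , orbit-cycle

-- Necessity: optimum distance forces injective projections.

module OptimumOrbit (F : FiniteField) (k : ℕ) (1<k : 1 < k) (a : Ops.Vec F (suc k)) (prim : Ops.IsPrimitive F a)
  (𝓕 : Ops.Flag F (k + suc k)) (full : Ops.IsFullFlag F (k + suc k) 𝓕)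
  (opt : Ops.IsOptimumDistance F (k + suc k) (Ops.Orbit F 𝓕 (Ops.blockDiag F (Ops.I F) (Ops.companion F a)))) where
  open FlagOrbit F k 1<k a prim 𝓕 full

  distances-optimal : ∀ i j → ¬ FlagEq n (𝓖 i) (𝓖 j) →
    ∀ t → 1 ≤ t → t < n → SubDist (𝓖 i t) (𝓖 j t) (2 * term n t)
  distances-optimal i j 𝓖ᵢ≢𝓖ⱼ = flagDist-tight (𝓖-dims i) (𝓖-dims j) (proj₂ dist)
    (proj₁ opt (𝓖 i) (𝓖 j) (i , λ _ _ _ → ≐-refl) (j , λ _ _ _ → ≐-refl) 𝓖ᵢ≢𝓖ⱼ _ (proj₂ dist))
    where dist = flagDist-exists (𝓖-dims i) (𝓖-dims j)

  P-∩-null : ∀ i j → ¬ FlagEq n (𝓖 i) (𝓖 j) → ∀ v → (𝓖 i k ∩ˢ 𝓖 j k) v → v ≋ 0ᵥ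
  P-∩-null i j 𝓖ᵢ≢𝓖ⱼ = dim-0⇒null (optimal⇒∩-null 2*k≤n (𝓖-dims i k 1≤k k<n) (𝓖-dims j k 1≤k k<n)
    (distances-optimal i j 𝓖ᵢ≢𝓖ⱼ k 1≤k k<n))

  -- A full sum leaves dimension `2 (k + 1) − (2k + 1) = 1` for the intersection.
  Q-∩-line : ∀ i j → ¬ FlagEq n (𝓖 i) (𝓖 j) → HasDim (𝓖 i (suc k) ∩ˢ 𝓖 j (suc k)) 1
  Q-∩-line i j 𝓖ᵢ≢𝓖ⱼ = subst (HasDim _) (ℕₚ.+-cancelˡ-≡ n _ 1 (trans n+d≡ (rearrange k))) d∩
    where
    ∩-dim = optimal⇒∩-dim 1+k<n (2*t≰n ℕₚ.≤-refl)
      (𝓖-dims i (suc k) (s≤s z≤n) 1+k<n) (𝓖-dims j (suc k) (s≤s z≤n) 1+k<n)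
      (distances-optimal i j 𝓖ᵢ≢𝓖ⱼ (suc k) (s≤s z≤n) 1+k<n)
    n+d≡ = proj₁ (proj₂ ∩-dim)
    d∩ = proj₂ (proj₂ ∩-dim)
    rearrange : ∀ k → suc k + suc k ≡ k + suc k + 1
    rearrange = solve-∀

  line-generator : ∀ {S : Subspace n} → HasDim S 1 →
    Σ[ z ∈ Vec n ] (S z × ¬ (z ≋ 0ᵥ) × (∀ v → S v → Σ[ s ∈ Carrier ] (v ≋ s ⊙ z)))
  line-generator (B , B-indep , S⊆B , B⊆S) =
    B zero , B⊆S _ (rowsp-row B zero) ,
    (λ B₀≋0 → 0≢1 (sym (B-indep (λ _ → 1F) (λ j → trans (+-identityʳ _) (trans (*-identityˡ _) (B₀≋0 j))) zero))) ,
    (λ v v∈S → let c , v≋cB = S⊆B v v∈S in c zero , λ j → trans (v≋cB j) (+-identityʳ _))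

  𝓖-0 : ∀ {t} → HasDim (𝓕 t) t → 𝓖 0 t ≐ˢ 𝓕 t
  𝓖-0 dim = (λ w (v , v∈ , w≋) → Closed.resp-≋ (dim⇒closed dim) (λ j → sym (trans (w≋ j) (·ᵥ-identity v j))) v∈) ,
            (λ v v∈ → v , v∈ , λ j → sym (·ᵥ-identity v j))

  stabilises : ∀ j → FlagEq n (𝓖 0) (𝓖 j) → ∀ t → 1 ≤ t → t < n → ∀ {v} → 𝓕 t v → 𝓕 t (v ▹ j)
  stabilises j eq t 1≤t t<n {v} v∈ =
    proj₁ (𝓖-0 (dims t 1≤t t<n)) _ (proj₂ (eq t 1≤t t<n) _ (v , v∈ , λ _ → refl))

  -- A nonzero vector moved inside P by g^j forces g^j to stabilise the whole flag.
  returning⇒stabiliser : ∀ j {v} → P v → ¬ (v ≋ 0ᵥ) → P (v ▹ j) → ¬ ¬ FlagEq n (𝓖 0) (𝓖 j)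
  returning⇒stabiliser j {v} v∈P v≢0 vgʲ∈P 𝓖₀≢𝓖ⱼ = v≢0 (▹-indep j v
    (P-∩-null 0 j 𝓖₀≢𝓖ⱼ (v ▹ j) (proj₂ (𝓖-0 dimP) _ vgʲ∈P , (v , v∈P , λ _ → refl))))

  -- A nonzero vector of P fixed by g would force the orbit to be a single flag.
  R-injective-P : InjectiveOn P R
  R-injective-P v v∈P Rv≋0 = go (proj₂ opt)
    where
    v∈𝓖 : ∀ e → 𝓖 e k v
    v∈𝓖 e = v , v∈P , λ j → sym (▹-fix e Rv≋0 j)
    go : _ → v ≋ 0ᵥ
    go (inj₁ (_ , _ , (i , eq₁) , (j , eq₂) , 𝓕₁≢𝓕₂ , _)) = P-∩-null i j
      (λ eq → 𝓕₁≢𝓕₂ (flagEq-trans eq₁ (flagEq-trans eq (flagEq-sym eq₂)))) v (v∈𝓖 i , v∈𝓖 j)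
    go (inj₂ (_ , _ , _ , odBound≡0)) = contradiction odBound≡0 odBound≢0

  module _ {p p′ : Vec n} (p∈P : P p) (p′∈P : P p′) (independent : ∀ s t → s ⊙ p′ ⊕ t ⊙ p ≋ 0ᵥ → s ≡ 0F) where

    partner-R≢0 : ¬ (R p′ ≋ 0ᵥ)
    partner-R≢0 Rp′≋0 = 0≢1 (sym (independent 1F 0F λ j → begin
      1F *F p′ j +F 0F *F p j   ≡⟨ cong₂ _+F_ (trans (*-identityˡ _) (R-injective-P p′ p′∈P Rp′≋0 j)) (zeroˡ (p j)) ⟩
      0F +F 0F                  ≡⟨ +-identityˡ 0F ⟩
      0F                        ∎))
      where open ≡-Reasoning

    -- `▹-move` requires nonzero right components. Independence keeps `p′ ⊕ t ⊙ p` nonzero, and a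
    -- nonzero vector of `P` has a nonzero right component.
    combination-R≢0 : ∀ t → ¬ (R (p′ ⊕ t ⊙ p) ≋ 0ᵥ)
    combination-R≢0 t R≋0 = 0≢1 (sym (independent 1F t λ j → trans (cong (_+F t *F p j) (*-identityˡ (p′ j)))
      (R-injective-P (p′ ⊕ t ⊙ p) (P.add p′∈P (P.scale t p∈P)) R≋0 j)))

  L-⊕ : ∀ v w → L w ≋ 0ᵥ → L v ≋ L (v ⊕ w)
  L-⊕ v w Lw≋0 j = sym (trans (cong (L v j +F_) (Lw≋0 j)) (+-identityʳ (L v j)))

  L≋0⇒R≢0 : ∀ {v} → ¬ (v ≋ 0ᵥ) → L v ≋ 0ᵥ → ¬ (R v ≋ 0ᵥ)
  L≋0⇒R≢0 v≢0 Lv≋0 Rv≋0 = v≢0 (L-R-ext Lv≋0 Rv≋0)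

  subtract-one : ∀ {x y s : Carrier} → x +F y ≡ s *F x → y ≡ (s +F -F 1F) *F x
  subtract-one {x} {y} {s} eq = +-cancelˡ x y _ (begin
    x +F y                               ≡⟨ eq ⟩
    s *F x                               ≡⟨ cong (_*F x) (x-y+y s 1F) ⟨
    (s +F -F 1F +F 1F) *F x              ≡⟨ distribʳ x _ 1F ⟩
    (s +F -F 1F) *F x +F 1F *F x         ≡⟨ cong ((s +F -F 1F) *F x +F_) (*-identityˡ x) ⟩
    (s +F -F 1F) *F x +F x               ≡⟨ +-comm _ x ⟩
    x +F (s +F -F 1F) *F x               ∎)
    where open ≡-Reasoning

  -- The eigenvector hypothesis holds for a generator of `𝓕 1`, since a stabiliser of the flag maps
  -- that line into itself.
  module _ {z : Vec n} (z∈P : P z) (z≢0 : ¬ (z ≋ 0ᵥ))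
           (z-eigen : ∀ j → FlagEq n (𝓖 0) (𝓖 j) → Σ[ s ∈ Carrier ] (z ▹ j ≋ s ⊙ z)) where

    -- Some g^j takes a partner z′ of z to z′ + z; it acts on the right block as a scalar s since z is an eigenvector,
    -- so (s − 1) z′ − z is fixed by g.
    generator-L≢0 : ¬ (L z ≋ 0ᵥ)
    generator-L≢0 Lz≋0 = returning⇒stabiliser j z′∈P z′≢0 (P.resp-≋ (λ l → sym (z′gʲ≋ l)) z′+z∈P) stabilised
      where
      open ≡-Reasoning
      partner = independent-partner dimP 1<k z∈P
      z′ = proj₁ partner
      z′∈P = proj₁ (proj₂ partner)
      independent = proj₂ (proj₂ partner)
      z′≢0 : ¬ (z′ ≋ 0ᵥ)
      z′≢0 z′≋0 = partner-R≢0 z∈P z′∈P independent (λ l → z′≋0 (k ↑ʳ l))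
      z′+z∈P : P (z′ ⊕ z)
      z′+z∈P = P.add z′∈P z∈P
      move = ▹-move {z′} {z′ ⊕ z} (L-⊕ z′ z Lz≋0) (partner-R≢0 z∈P z′∈P independent)
        (λ R≋0 → combination-R≢0 z∈P z′∈P independent 1F
          (λ l → trans (cong (R z′ l +F_) (*-identityˡ (R z l))) (R≋0 l)))
      j = proj₁ move
      z′gʲ≋ = proj₂ move
      stabilised : ¬ FlagEq n (𝓖 0) (𝓖 j)
      stabilised eq = L≋0⇒R≢0 z≢0 Lz≋0 λ l → trans (Rz≋ l) (trans (cong (_*F R z′ l) s-1≡0) (zeroˡ (R z′ l)))
        where
        s = proj₁ (z-eigen j eq)
        s-1 = s +F -F 1F
        scalar : ∀ w → w ·ᵥ M ^ₘ j ≋ s ⊙ (w ·ᵥ M ^ₘ 0)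
        scalar = rigid j 0 s (L≋0⇒R≢0 z≢0 Lz≋0) λ l → begin
          (R z ·ᵥ M ^ₘ j) l          ≡⟨ R-▹ j z l ⟨
          R (z ▹ j) l                ≡⟨ proj₂ (z-eigen j eq) (k ↑ʳ l) ⟩
          s *F R z l                 ≡⟨ cong (s *F_) (·ᵥ-identity (R z) l) ⟨
          s *F (R z ·ᵥ M ^ₘ 0) l     ∎
        Rz≋ : R z ≋ s-1 ⊙ R z′
        Rz≋ l = subtract-one (begin
          R z′ l +F R z l            ≡⟨ z′gʲ≋ (k ↑ʳ l) ⟨
          R (z′ ▹ j) l               ≡⟨ R-▹ j z′ l ⟩
          (R z′ ·ᵥ M ^ₘ j) l         ≡⟨ scalar (R z′) l ⟩
          s *F (R z′ ·ᵥ M ^ₘ 0) l    ≡⟨ cong (s *F_) (·ᵥ-identity (R z′) l) ⟩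
          s *F R z′ l                ∎)
        s-1≡0 : s-1 ≡ 0F
        s-1≡0 = independent s-1 (-F 1F) λ l → R-injective-P (s-1 ⊙ z′ ⊕ -F 1F ⊙ z) (P.add (P.scale s-1 z′∈P) (P.scale (-F 1F) z∈P))
          (λ l → trans (cong₂ _+F_ (sym (Rz≋ l)) (-1*x≈-x (R z l))) (-‿inverseʳ (R z l))) l

    -- If `w` in `P` has left component 0, some `g^j` takes `z` to `z + w` and so stabilises the
    -- flag. As `z` is an eigenvector, `w` is a multiple of `z`; since `z` has a nonzero left
    -- component and `w` has none, the multiple is 0.
    generator⇒L-injective : InjectiveOn P L
    generator⇒L-injective w w∈P Lw≋0 with w ≟ᵥ 0ᵥ
    ... | yes w≋0 = w≋0
    ... | no w≢0 = contradiction stabilised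
      (returning⇒stabiliser (proj₁ move) z∈P z≢0 (P.resp-≋ (λ l → sym (proj₂ move l)) z+w∈P))
      where
      open ≡-Reasoning
      z+w∈P : P (z ⊕ w)
      z+w∈P = P.add z∈P w∈P
      R≢0 : ∀ {v} → P v → L v ≋ L z → ¬ (R v ≋ 0ᵥ)
      R≢0 v∈P Lv≋Lz Rv≋0 = generator-L≢0 λ l → trans (sym (Lv≋Lz l)) (R-injective-P _ v∈P Rv≋0 (l ↑ˡ suc k))
      move = ▹-move {z} {z ⊕ w} (L-⊕ z w Lw≋0) (R≢0 z∈P (λ _ → refl)) (R≢0 z+w∈P (λ l → sym (L-⊕ z w Lw≋0 l)))
      stabilised : ¬ FlagEq n (𝓖 0) (𝓖 (proj₁ move))
      stabilised eq = decideScalar (s-1 ≟F 0F)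
        where
        s = proj₁ (z-eigen (proj₁ move) eq)
        s-1 = s +F -F 1F
        w≋ : w ≋ s-1 ⊙ z
        w≋ l = subtract-one (trans (sym (proj₂ move l)) (proj₂ (z-eigen (proj₁ move) eq) l))
        decideScalar : Dec (s-1 ≡ 0F) → ⊥
        decideScalar (yes s-1≡0) = w≢0 λ l → trans (w≋ l) (trans (cong (_*F z l) s-1≡0) (zeroˡ (z l)))
        decideScalar (no s-1≢0)  = generator-L≢0
          (cancel-scalar null-closed s-1≢0 λ l → trans (sym (w≋ (l ↑ˡ suc k))) (Lw≋0 l))

  L-injective-P : InjectiveOn P L
  L-injective-P = generator⇒L-injective (𝓕₁⊆P z z∈𝓕₁) z≢0
    λ j eq → 𝓕₁-line (z ▹ j) (stabilises j eq 1 ℕₚ.≤-refl 1<n z∈𝓕₁)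
    where
    1<n : 1 < n
    1<n = ℕₚ.<-trans 1<k k<n
    generator = line-generator (dims 1 ℕₚ.≤-refl 1<n)
    z = proj₁ generator
    z∈𝓕₁ = proj₁ (proj₂ generator)
    z≢0 = proj₁ (proj₂ (proj₂ generator))
    𝓕₁-line = proj₂ (proj₂ (proj₂ generator))
    𝓕₁⊆P : 𝓕 1 ⊆ˢ P
    𝓕₁⊆P = flag-chain full ℕₚ.≤-refl 1≤k k<n

  -- A nonzero `w` on the line with zero right component forces the same on the generator, hence on
  -- all multiples of it.
  line-proportional : ∀ {S : Subspace n} {w u} → HasDim S 1 → S w → S u → ¬ (w ≋ 0ᵥ) → R w ≋ 0ᵥ → R u ≋ 0ᵥ
  line-proportional {w = w} {u} dimS w∈S u∈S w≢0 Rw≋0 l =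
    trans (u≋βb (k ↑ʳ l)) (trans (cong (β *F_) (cancel-scalar null-closed α≢0 Rαb≋0 l)) (zeroʳ β))
    where
    generator = line-generator dimS
    multiple = proj₂ (proj₂ (proj₂ generator))
    b = proj₁ generator
    α = proj₁ (multiple w w∈S)
    w≋αb = proj₂ (multiple w w∈S)
    β = proj₁ (multiple u u∈S)
    u≋βb = proj₂ (multiple u u∈S)
    α≢0 : ¬ (α ≡ 0F)
    α≢0 α≡0 = w≢0 λ j → trans (w≋αb j) (trans (cong (_*F b j) α≡0) (zeroˡ (b j)))
    Rαb≋0 : α ⊙ R b ≋ 0ᵥ
    Rαb≋0 l = trans (sym (w≋αb (k ↑ʳ l))) (Rw≋0 l)

  -- If w = (c, 0) ∈ Q, take p = (c, y) ∈ P and a partner p′; some g^j takes p′ to p′ − (0, y), which is in Q,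
  -- so Q ∩ Q g^j contains two independent vectors.
  R-injective-Q : SurjectiveOn P L → InjectiveOn Q R
  R-injective-Q P-surj w w∈Q Rw≋0 with w ≟ᵥ 0ᵥ
  ... | yes w≋0 = w≋0
  ... | no w≢0 = contradiction (line-proportional (Q-∩-line 0 j 𝓖₀≢𝓖ⱼ) (w∈𝓖 0 , w∈𝓖 j)
      (proj₂ (𝓖-0 dimQ) _ u∈Q , (p′ , P⊆Q p′ p′∈P , λ l → sym (p′gʲ≋u l))) w≢0 Rw≋0) Ru≢0
    where
    open ≡-Reasoning
    p = proj₁ (P-surj (L w))
    p∈P = proj₁ (proj₂ (P-surj (L w)))
    Lp≋Lw = proj₂ (proj₂ (P-surj (L w)))
    partner = independent-partner dimP 1<k p∈P
    p′ = proj₁ partner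
    p′∈P = proj₁ (proj₂ partner)
    independent = proj₂ (proj₂ partner)
    d = p ⊕ ⊖ w
    u = p′ ⊕ ⊖ d
    u∈Q : Q u
    u∈Q = Q.add (P⊆Q p′ p′∈P) (Q.neg (Q.add (P⊆Q p p∈P) (Q.neg w∈Q)))
    w∈𝓖 : ∀ e → 𝓖 e (suc k) w
    w∈𝓖 e = w , w∈Q , λ l → sym (▹-fix e Rw≋0 l)
    Rp≢0 : ¬ (R p ≋ 0ᵥ)
    Rp≢0 Rp≋0 = w≢0 (L-R-ext (λ l → trans (sym (Lp≋Lw l)) (R-injective-P p p∈P Rp≋0 (l ↑ˡ suc k))) Rw≋0)
    Rd≋Rp : R d ≋ R p
    Rd≋Rp l = trans (cong (R p l +F_) (trans (cong -F_ (Rw≋0 l)) -0≡0)) (+-identityʳ (R p l))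
    Lu : L (⊖ d) ≋ 0ᵥ
    Lu l = trans (cong -F_ (⊕-⊖ (L p) (L w) Lp≋Lw l)) -0≡0
    Ru≢0 : ¬ (R u ≋ 0ᵥ)
    Ru≢0 Ru≋0 = combination-R≢0 p∈P p′∈P independent (-F 1F) λ l → begin
      R p′ l +F -F 1F *F R p l   ≡⟨ cong (R p′ l +F_) (trans (-1*x≈-x (R p l)) (cong -F_ (sym (Rd≋Rp l)))) ⟩
      R u l                      ≡⟨ Ru≋0 l ⟩
      0F                         ∎
    move = ▹-move {p′} {u} (L-⊕ p′ (⊖ d) Lu) (partner-R≢0 p∈P p′∈P independent) Ru≢0
    j = proj₁ move
    p′gʲ≋u = proj₂ move
    𝓖₀≢𝓖ⱼ : ¬ FlagEq n (𝓖 0) (𝓖 j)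
    -- A stabiliser would keep `u` in `P`, and with it `d = p′ − u`, whose left component is 0.
    -- Injectivity of `L` on `P` then gives `d = 0`, although `d` has the nonzero right component of
    -- `p`.
    𝓖₀≢𝓖ⱼ eq = Rp≢0 λ l → begin
      R p l              ≡⟨ Rd≋Rp l ⟨
      R d l              ≡⟨ d≋ (k ↑ʳ l) ⟨
      R (p′ ⊕ ⊖ u) l     ≡⟨ L-injective-P (p′ ⊕ ⊖ u) (P.add p′∈P (P.neg u∈P)) (λ l → trans (d≋ (l ↑ˡ suc k)) (⊕-⊖ (L p) (L w) Lp≋Lw l)) (k ↑ʳ l) ⟩
      0F                 ∎
      where
      u∈P : P u
      u∈P = P.resp-≋ p′gʲ≋u (stabilises j eq k 1≤k k<n p′∈P)
      d≋ : p′ ⊕ ⊖ u ≋ d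
      d≋ l = sym (+-cancelʳ (u l) (d l) ((p′ ⊕ ⊖ u) l) (begin
        d l +F (p′ l +F -F d l)     ≡⟨ +-comm _ _ ⟩
        p′ l +F -F d l +F d l       ≡⟨ x-y+y (p′ l) (d l) ⟩
        p′ l                        ≡⟨ x-y+y (p′ l) (u l) ⟨
        p′ l +F -F u l +F u l       ∎))

-- The equivalence with invertibility of the two blocks, and the orbit size.

theorem5p7 : (F : FiniteField) → let open Ops F in
    (k : ℕ) → 1 < k →
    (a : Vec (suc k)) → IsPrimitive a →
    (U₁ : Mat k k) (U₂ : Mat k (suc k)) (v₁ : Vec k) (v₂ : Vec (suc k)) →
    HasRank (hcat U₁ U₂) k →
    HasRank (hcat (addRow U₁ v₁) (addRow U₂ v₂)) (suc k) →
    (𝓕 : Flag (k + suc k)) → IsFullFlag (k + suc k) 𝓕 →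
    𝓕 k ≐ˢ InRowsp (hcat U₁ U₂) →
    𝓕 (suc k) ≐ˢ InRowsp (hcat (addRow U₁ v₁) (addRow U₂ v₂)) →
    ((IsOptimumDistance (k + suc k) (Orbit 𝓕 (blockDiag I (companion a)))
    → Invertible U₁ × Invertible (addRow U₂ v₂))
    × (Invertible U₁ × Invertible (addRow U₂ v₂)
    → IsOptimumDistance (k + suc k) (Orbit 𝓕 (blockDiag I (companion a)))))
    × (IsOptimumDistance (k + suc k) (Orbit 𝓕 (blockDiag I (companion a)))
    → OrbitCard 𝓕 (blockDiag I (companion a)) (q ^ suc k ∸ 1)
    × GroupOrder (blockDiag {k} I (companion a)) (q ^ suc k ∸ 1))
theorem5p7 F k 1<k a prim U₁ U₂ v₁ v₂ rankU rankV 𝓕 full P≐ Q≐ =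
  (invertible , isOptimum) , λ opt → orbit-card (invertible opt) , group-order
  where
  open FlagOrbit F k 1<k a prim 𝓕 full
  V₁ = addRow U₁ v₁
  V₂ = addRow U₂ v₂
  module U = SquareBlock P (hcat U₁ U₂) P≐ U₁ L (λ v≋w l → v≋w (l ↑ˡ suc k)) (L-hcat U₁ U₂)
  module V = SquareBlock Q (hcat V₁ V₂) Q≐ V₂ R (λ v≋w l → v≋w (k ↑ʳ l)) (R-hcat V₁ V₂)

  module Sufficient′ ((U-inv , V-inv) : Invertible U₁ × Invertible V₂) = Sufficient
    (U.invertible⇒injective U-inv) (U.invertible⇒surjective U-inv)
    (V.invertible⇒injective V-inv) (V.invertible⇒surjective V-inv)
  open Sufficient′ using (isOptimum; orbit-card)

  invertible : IsOptimumDistance n (Orbit 𝓕 g) → Invertible U₁ × Invertible V₂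
  invertible opt = U₁-invertible ,
    -- The block `U₁` has to be settled before `V₂`: the argument for `Q` lifts a left component to
    -- `P`, which takes surjectivity of `L` on `P`.
    V.injective⇒invertible rankV (R-injective-Q (U.invertible⇒surjective U₁-invertible))
    where
    open OptimumOrbit F k 1<k a prim 𝓕 full opt
    U₁-invertible = U.injective⇒invertible rankU L-injective-P
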